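{- Let $n\ge1$, $0\le m<n$, let $a_1,\dots,a_n$ be nonnegative integers, and fix $r\in\{1,\dots,n\}$. Let $M=\{r+1,\dots,r+m\}$, where indices are understood modulo $n$ (as elements of $\{1,\dots,n\}$). For $1\le i<j\le n$ define $a_i^*(j)=a_i+\chi(j\in M,\ i=r)$ and $a_j^*(i)=a_j+\chi(i\in M,\ j=r)$. Then \[ \mathrm{CT}\Bigg[\prod_{1\le i<j\le n}\left(\frac{x_i}{x_j}\right)_{a_i^*(j)}\left(\frac{qx_j}{x_i}\right)_{a_j^*(i)}\Bigg]=\frac{1-q^{1+|\mathbf a|}}{1-q^{1+\sum_{v\notin M}a_v}}\begin{bmatrix}|\mathbf a|\\ \mathbf a\end{bmatrix}_q. \]
   Context: $q$ and $x_1,\dots,x_n$ are independent indeterminates; $\mathrm{CT}$ denotes the constant term with respect to $x_1,\dots,x_n$ of a Laurent polynomial with coefficients in $\mathbb{Q}(q)$. $(t)_k=(1-t)(1-tq)\cdots(1-tq^{k-1})$, $(t)_0=1$. $|\mathbf a|=a_1+\dots+a_n$, $\begin{bmatrix}|\mathbf a|\\ \mathbf a\end{bmatrix}_q=\frac{(q)_{|\mathbf a|}}{(q)_{a_1}\cdots(q)_{a_n}}$, and $\chi(S)$ is $1$ if $S$ is true and $0$ otherwise. -}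

module Defs where

open import Data.Bool using (Bool; true; false; _∧_; not; if_then_else_)
open import Data.Nat as ℕ using (ℕ; zero; suc; _∸_; _<ᵇ_; _≤ᵇ_)
open import Data.Integer as ℤ using (ℤ; +_; 0ℤ; 1ℤ; -_)
open import Data.Fin as Fin using (Fin; toℕ)
open import Data.List using (List; []; _∷_; _++_; map; concatMap; foldr; allFin; upTo)
open import Relation.Nullary using (does)
open import Data.Product using (_×_; _,_)
open import Relation.Binary.PropositionalEquality using (_≡_)

-- Laurent polynomials in x_1..x_n (indices Fin n) with coefficients in ℤ[q],
-- represented as formal sums (lists) of terms  c · q^e · x^v .

record Term (n : ℕ) : Set where
  constructor term
  field
    coef  : ℤ
    qexp  : ℕ
    xexp  : Fin n → ℤ

Poly : ℕ → Set
Poly n = List (Term n)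

zeroVec : ∀ {n} → Fin n → ℤ
zeroVec _ = 0ℤ

addVec : ∀ {n} → (Fin n → ℤ) → (Fin n → ℤ) → Fin n → ℤ
addVec u v k = u k ℤ.+ v k

termMul : ∀ {n} → Term n → Term n → Term n
termMul (term c e u) (term d f v) = term (c ℤ.* d) (e ℕ.+ f) (addVec u v)

1P : ∀ {n} → Poly n
1P = term 1ℤ 0 zeroVec ∷ []

_+P_ : ∀ {n} → Poly n → Poly n → Poly n
p +P p' = p ++ p'

negP : ∀ {n} → Poly n → Poly n
negP = map (λ { (term c e v) → term (ℤ.- c) e v })

_-P_ : ∀ {n} → Poly n → Poly n → Poly n
p -P p' = p +P negP p'

_*P_ : ∀ {n} → Poly n → Poly n → Poly n
p *P p' = concatMap (λ s → map (termMul s) p') p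

prodP : ∀ {n} {A : Set} → (A → Poly n) → List A → Poly n
prodP f = foldr (λ a acc → f a *P acc) 1P

mono : ∀ {n} → ℕ → (Fin n → ℤ) → Poly n
mono e v = term 1ℤ e v ∷ []

qpow : ∀ {n} → ℕ → Poly n
qpow e = mono e zeroVec

-- (t)_k with t = q^e x^v :  ∏_{l<k} (1 - q^{e+l} x^v)
poch : ∀ {n} → ℕ → (Fin n → ℤ) → ℕ → Poly n
poch e v k = prodP (λ l → 1P -P mono (e ℕ.+ l) v) (upTo k)

qfac : ∀ {n} → ℕ → Poly n
qfac k = poch 1 zeroVec k

allZero : ∀ {n} → (Fin n → ℤ) → Bool
allZero {zero}  v = true
allZero {suc n} v = does (v Fin.zero ℤ.≟ 0ℤ) ∧ allZero (λ k → v (Fin.suc k))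

CT : ∀ {n} → Poly n → Poly 0
CT [] = []
CT (term c e v ∷ p) = if allZero v then term c e zeroVec ∷ CT p else CT p

qcoeff : ℕ → Poly 0 → ℤ
qcoeff k [] = 0ℤ
qcoeff k (term c e _ ∷ p) = (if does (e ℕ.≟ k) then c else 0ℤ) ℤ.+ qcoeff k p

_≈q_ : Poly 0 → Poly 0 → Set
P ≈q Q = ∀ k → qcoeff k P ≡ qcoeff k Q

-- data of the theorem (indices 0-based: Fin n stands for {1,…,n})

χ : Bool → ℕ
χ true  = 1
χ false = 0

_==F_ : ∀ {n} → Fin n → Fin n → Bool
i ==F j = does (i Fin.≟ j)

cdist : ∀ {n} → Fin n → Fin n → ℕ
cdist {n} r j = if toℕ r ≤ᵇ toℕ j then toℕ j ∸ toℕ r else (toℕ j ℕ.+ n) ∸ toℕ r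

inM : ∀ {n} → ℕ → Fin n → Fin n → Bool
inM m r j = (1 ≤ᵇ cdist r j) ∧ (cdist r j ≤ᵇ m)

-- e_i - e_j  (exponent vector of x_i / x_j)
ratio : ∀ {n} → Fin n → Fin n → Fin n → ℤ
ratio i j k = (if k ==F i then 1ℤ else 0ℤ) ℤ.- (if k ==F j then 1ℤ else 0ℤ)

pairs : ∀ n → List (Fin n × Fin n)
pairs n = concatMap (λ i → concatMap (λ j → if toℕ i <ᵇ toℕ j then (i , j) ∷ [] else []) (allFin n)) (allFin n)

sumFin : ∀ n → (Fin n → ℕ) → ℕ
sumFin n f = foldr ℕ._+_ 0 (map f (allFin n))

absA : ∀ {n} → (Fin n → ℕ) → ℕ
absA {n} a = sumFin n a

sumOutM : ∀ {n} → ℕ → Fin n → (Fin n → ℕ) → ℕ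
sumOutM {n} m r a = sumFin n (λ v → if inM m r v then 0 else a v)

aStar : ∀ {n} → ℕ → Fin n → (Fin n → ℕ) → Fin n → Fin n → ℕ
aStar m r a i j = a i ℕ.+ χ (inM m r j ∧ (i ==F r))

LHSprod : ∀ n → ℕ → Fin n → (Fin n → ℕ) → Poly n
LHSprod n m r a = prodP factor (pairs n)
  where
  factor : Fin n × Fin n → Poly n
  factor (i , j) = poch 0 (ratio i j) (aStar m r a i j) *P poch 1 (ratio j i) (aStar m r a j i)

{-# OPTIONS --safe #-}
module Submission where

-- Fix an integer q ≥ 3 and let p be the cyclic order r+1, …, n, 1, …, r.  Every monomial x^v of the product satisfies
-- Σ v_i = 0 and v_i ≥ −d_i with d_i = |a| − a_i + χ(i ∈ M), and the polynomial ∏_{k=1}^{d_i} (y − q^{-k}) vanishes at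
-- y = q^{v_i} whenever −d_i ≤ v_i < 0.  Expanding these polynomials therefore writes the constant term as a weighted sum
-- of the values of the product at the points x_i = q^{α_i + χ(i ≤ r)}, 0 ≤ α_i ≤ d_i (Károlyi–Nagy).  All values vanish
-- except the one where α consists of the partial sums of a along p: sort the indices by α (ties by p); a nonzero value
-- forces each gap to be at least a_i plus a subadditive cost, and the box leaves no room for any cost.  The one surviving
-- term telescopes to the claimed right-hand side up to a factor ± q^e.  Both sides are integers congruent to 1 modulo q,
-- so that factor is 1, and an identity of polynomials valid for all integers q ≥ 3 holds coefficientwise.

open import Defs
open import Data.Bool using (Bool; true; false; _∧_; if_then_else_)
open import Data.Bool.Properties using (∧-zeroʳ)
open import Data.Nat as ℕ using (ℕ; zero; suc; _≤_; _<_; _∸_; _<ᵇ_; _≤ᵇ_; z≤n; s≤s)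
import Data.Nat.Properties as ℕ
import Data.Nat.Divisibility as ℕ
open import Data.Nat.ListAction using (sum)
open import Data.Nat.ListAction.Properties using (sum-↭; sum-++)
import Data.Nat.Tactic.RingSolver as ℕ-Solver
open import Data.Integer as ℤ using (ℤ; -[1+_]; _⊖_; 0ℤ; 1ℤ; ∣_∣) renaming (+_ to pos)
import Data.Integer.Properties as ℤ
import Data.Integer.Tactic.RingSolver as ℤ-Solver
open import Data.Rational as ℚ using (ℚ; 0ℚ; 1ℚ)
import Data.Rational.Properties as ℚ
open import Data.Rational.Solver using (module +-*-Solver)
import Data.Rational.Unnormalised as ℚᵘ
import Data.Rational.Unnormalised.Properties as ℚᵘ
open import Algebra.Properties.AbelianGroup ℤ.+-0-abelianGroup using () renaming (∙-cancelˡ to +-cancelˡ)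
open import Data.Fin as Fin using (Fin; toℕ)
import Data.Fin.Properties as Fin
open import Data.List using (List; []; _∷_; _++_; map; concatMap; foldr; allFin; upTo; applyUpTo; tabulate; length)
open import Data.List.Properties using (map-++; map-∘; length-upTo)
open import Data.List.Membership.Propositional using (_∈_)
open import Data.List.Membership.Propositional.Properties using (∈-allFin)
open import Data.List.Relation.Binary.Permutation.Propositional as ↭ using (_↭_; ↭-sym; ↭-trans; ↭⇒↭ₛ)
import Data.List.Relation.Binary.Permutation.Propositional.Properties as Perm
import Data.List.Relation.Binary.Permutation.Homogeneous as Homogeneous
import Data.List.Relation.Binary.Permutation.Setoid.Properties as PermS
open import Data.List.Relation.Binary.Pointwise using (Pointwise; []; _∷_)
open import Data.List.Relation.Unary.All as All using (All; []; _∷_)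
import Data.List.Relation.Unary.All.Properties as All
open import Data.List.Relation.Unary.AllPairs as AllPairs using (AllPairs; []; _∷_)
import Data.List.Relation.Unary.AllPairs.Properties as AllPairs
open import Data.List.Relation.Unary.Any using (here; there)
open import Data.List.Relation.Unary.Linked using (Linked; []; [-]; _∷_)
open import Data.List.Relation.Unary.Linked.Properties using (Linked⇒AllPairs)
open import Data.List.Relation.Unary.Sorted.TotalOrder.Properties using (↗↭↗⇒≋)
open import Data.List.Relation.Unary.Unique.Propositional using (Unique)
open import Data.List.Relation.Unary.Unique.Propositional.Properties using (allFin⁺)
import Data.List.Sort as Sort
open import Data.Vec as Vec using (Vec; []; _∷_; lookup)
open import Data.Vec.Properties using (lookup∘tabulate; tabulate∘lookup; tabulate-cong)
open import Data.Product using (∃; _×_; _,_; proj₁; proj₂; uncurry)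
open import Data.Sum using (_⊎_; inj₁; inj₂)
open import Data.Empty using (⊥; ⊥-elim)
open import Function using (_∘_; id)
open import Relation.Binary.Bundles using (DecTotalOrder)
import Relation.Binary.Construct.On as On
open import Relation.Binary.Definitions using (tri<; tri≈; tri>)
open import Relation.Nullary using (¬_; Dec; yes; no; does; contradiction)
open import Relation.Nullary.Decidable using (dec-true; dec-false; ¬?; _×-dec_)
open import Relation.Binary.PropositionalEquality hiding ([_])

-- The coefficients live in ℤ[q], but the interpolation needs 1/q and cancels factors 1 - q^(-k).
-- Specialising q to integers replaces the field ℚ(q) by ℚ, where these factors are visibly
-- invertible. The bound 3 keeps 1 and -1 apart modulo q, so that even the sign of the last factor
-- can be read off from a congruence.
--
-- The cyclic order is chosen to put `M` first and `r` last. An index in `M` has one unit more room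
-- in the box than the others, and the only raised exponents belong to the ordered pairs (r, j) with
-- j in `M`. In this order a passage from `r` to `M` is also a descent, so it costs 2, more than the
-- additional unit can pay; hence the surviving point is unique. The translation of the grid by 1 on
-- the indices up to `r` is what changes the order: the factor q is attached to pairs according to
-- the natural order, and after the translation according to the cyclic one.

module Combinatorics where

  open import Data.Nat using (_+_; _*_)

  -- The nonvanishing point

  χ≤1 : ∀ b → χ b ≤ 1
  χ≤1 true = s≤s z≤n
  χ≤1 false = z≤n

  χ<-yes : ∀ {x y} → x < y → χ (x <ᵇ y) ≡ 1
  χ<-yes {x} {y} lt = cong χ (dec-true (x ℕ.<? y) lt)

  χ<-no : ∀ {x y} → y ≤ x → χ (x <ᵇ y) ≡ 0
  χ<-no {x} {y} le = cong χ (dec-false (x ℕ.<? y) (ℕ.≤⇒≯ le))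

  χ<-zero : ∀ {x y} → χ (x <ᵇ y) ≡ 0 → y ≤ x
  χ<-zero {x} {y} eq with x ℕ.<? y
  ... | no ¬lt = ℕ.≮⇒≥ ¬lt
  ... | yes lt with () ← trans (sym (χ<-yes lt)) eq

  χ<-triangle : ∀ x y z → χ (z <ᵇ x) ≤ χ (y <ᵇ x) + χ (z <ᵇ y)
  χ<-triangle x y z with y ℕ.<? x | z ℕ.<? y
  ... | yes lt | _ = ℕ.≤-trans (χ≤1 (z <ᵇ x)) (ℕ.≤-trans (ℕ.≤-reflexive (sym (χ<-yes lt))) (ℕ.m≤m+n _ _))
  ... | no _ | yes lt = ℕ.≤-trans (χ≤1 (z <ᵇ x)) (ℕ.≤-trans (ℕ.≤-reflexive (sym (χ<-yes lt))) (ℕ.m≤n+m _ _))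
  ... | no ¬yx | no ¬zy = ℕ.≤-trans (ℕ.≤-reflexive (χ<-no (ℕ.≤-trans (ℕ.≮⇒≥ ¬yx) (ℕ.≮⇒≥ ¬zy)))) z≤n

  ==F-refl : ∀ {n} (i : Fin n) → (i ==F i) ≡ true
  ==F-refl i = dec-true (i Fin.≟ i) refl

  ==F-≢ : ∀ {n} {i j : Fin n} → i ≢ j → (i ==F j) ≡ false
  ==F-≢ {i = i} {j} = dec-false (i Fin.≟ j)

  module _ {n : ℕ} (key : Fin n → ℕ) where

    private
      keyOrder : DecTotalOrder _ _ _
      keyOrder = On.decTotalOrder ℕ.≤-decTotalOrder key

    sortBy : List (Fin n) → List (Fin n)
    sortBy = Sort.sort keyOrder

    sortBy-↭ : ∀ l → sortBy l ↭ l
    sortBy-↭ = Sort.sort-↭ keyOrder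

    sortBy-↗ : ∀ l → Linked (λ i j → key i ≤ key j) (sortBy l)
    sortBy-↗ = Sort.sort-↗ keyOrder

    sorted-unique : (∀ {i j} → key i ≡ key j → i ≡ j) → ∀ {l l′} → l ↭ l′ →
      Linked (λ i j → key i ≤ key j) l → Linked (λ i j → key i ≤ key j) l′ → l ≡ l′
    sorted-unique inj l↭l′ l↗ l′↗ =
      pointwise (↗↭↗⇒≋ (DecTotalOrder.totalOrder keyOrder) l↗ l′↗ (Homogeneous.map (cong key) (↭⇒↭ₛ l↭l′)))
      where
      pointwise : ∀ {l l′} → Pointwise (λ i j → key i ≡ key j) l l′ → l ≡ l′
      pointwise [] = refl
      pointwise (e ∷ es) = cong₂ _∷_ (inj e) (pointwise es)

  linked-≢ : ∀ {A : Set} {R : A → A → Set} {S : A → A → Set} → (∀ {x y} → R x y → x ≢ y → S x y) →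
    ∀ {l} → Linked R l → Unique l → Linked S l
  linked-≢ f [] _ = []
  linked-≢ f [-] _ = [-]
  linked-≢ f (Rxy ∷ Rs) ((x≢y ∷ _) ∷ u) = f Rxy x≢y ∷ linked-≢ f Rs u

  unique-↭ : ∀ {A : Set} {l l′ : List A} → l ↭ l′ → Unique l → Unique l′
  unique-↭ {A} l↭l′ = PermS.Unique-resp-↭ (setoid A) (↭⇒↭ₛ l↭l′)

  module Prefixes {n : ℕ} (a : Fin n → ℕ) where

    total : List (Fin n) → ℕ
    total l = sum (map a l)

    total-↭ : ∀ {l l′} → l ↭ l′ → total l ≡ total l′
    total-↭ eq = sum-↭ (Perm.map⁺ a eq)

    data Prefix (α : Fin n → ℕ) : ℕ → List (Fin n) → Set where
      []  : ∀ {A} → Prefix α A []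
      _∷_ : ∀ {A x xs} → α x ≡ A → Prefix α (A + a x) xs → Prefix α A (x ∷ xs)

    Prefix-unique : ∀ {α α′ A l} → Prefix α A l → Prefix α′ A l → ∀ {i} → i ∈ l → α i ≡ α′ i
    Prefix-unique (e ∷ _) (e′ ∷ _) (here refl) = trans e (sym e′)
    Prefix-unique (_ ∷ es) (_ ∷ es′) (there i∈) = Prefix-unique es es′ i∈

  module Positions
    {n : ℕ} (a : Fin n → ℕ) (p : Fin n → ℕ) (p-inj : ∀ {i j} → p i ≡ p j → i ≡ j)
    (r : Fin n) (r-top : ∀ {i} → i ≢ r → p i < p r)
    (M : Fin n → Bool) (r∉M : M r ≡ false)
    (M-initial : ∀ {i j} → M i ≡ true → M j ≡ false → p i < p j)
    where

    open Prefixes a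

    -- The excess of the gap forced between consecutive positions i, j over a i; a descent against p costs 1, and so
    -- does leaving r for an element of M.
    cost : Fin n → Fin n → ℕ
    cost i j = χ (p j <ᵇ p i) + χ (M j ∧ (i ==F r))

    order : List (Fin n)
    order = sortBy p (allFin n)

    M⇒≢r : ∀ {i} → M i ≡ true → i ≢ r
    M⇒≢r Mi refl with () ← trans (sym Mi) r∉M

    cost-rM : ∀ {j} → M j ≡ true → cost r j ≡ 2
    cost-rM {j} Mj rewrite Mj | ==F-refl r = cong (_+ 1) (χ<-yes (r-top (M⇒≢r Mj)))

    ∧-==F⇒ : ∀ b {i} → (b ∧ (i ==F r)) ≡ true → b ≡ true × i ≡ r
    ∧-==F⇒ true {i} e with i Fin.≟ r
    ... | yes i≡r = refl , i≡r

    cost-refl : ∀ i → cost i i ≡ 0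
    cost-refl i with M i ∧ (i ==F r) in e
    ... | false = trans (ℕ.+-identityʳ _) (χ<-no {p i} ℕ.≤-refl)
    ... | true with ∧-==F⇒ (M i) {i} e
    ...   | Mi , refl = contradiction refl (M⇒≢r Mi)

    χ≤cost : ∀ i j → χ (p j <ᵇ p i) ≤ cost i j
    χ≤cost i j = ℕ.m≤m+n _ _

    -- The descent indicator is subadditive. The only other case is a passage from `r` to j in `M`,
    -- of cost 2: a detour through k in `M` pays 2 on its first step, one through `r` itself pays 2
    -- on its second, and through any other k both steps are descents, since `r` is on top and `M`
    -- lies at the bottom.
    cost-triangle : ∀ i k j → cost i j ≤ cost i k + cost k j
    cost-triangle i k j with M j ∧ (i ==F r) in e
    ... | false = ℕ.≤-trans (ℕ.≤-reflexive (ℕ.+-identityʳ _))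
        (ℕ.≤-trans (χ<-triangle (p i) (p k) (p j)) (ℕ.+-mono-≤ (χ≤cost i k) (χ≤cost k j)))
    ... | true with ∧-==F⇒ (M j) {i} e
    ...   | Mj , refl = ℕ.≤-trans (ℕ.+-monoˡ-≤ 1 (χ≤1 (p j <ᵇ p r))) (via k (k Fin.≟ r) (M k) refl)
      where
      via : ∀ k → Dec (k ≡ r) → ∀ b → M k ≡ b → 2 ≤ cost r k + cost k j
      via k _ true Mk = ℕ.≤-trans (ℕ.≤-reflexive (sym (cost-rM Mk))) (ℕ.m≤m+n _ _)
      via k (yes refl) false _ = ℕ.≤-trans (ℕ.≤-reflexive (sym (cost-rM Mj))) (ℕ.m≤n+m _ (cost r r))
      via k (no k≢r) false Mk = ℕ.+-mono-≤
        (ℕ.≤-trans (ℕ.≤-reflexive (sym (χ<-yes (r-top k≢r)))) (χ≤cost r k))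
        (ℕ.≤-trans (ℕ.≤-reflexive (sym (χ<-yes (M-initial Mj Mk)))) (χ≤cost k j))

    final : Fin n → List (Fin n) → Fin n
    final x [] = x
    final x (y ∷ ys) = final y ys

    module _ (α : Fin n → ℕ) where

      Gap : Fin n → Fin n → Set
      Gap i j = α i + a i + cost i j ≤ α j

      open ℕ.≤-Reasoning

      -- The gaps are added up along the list; the triangle inequality collapses all costs into the
      -- one between the two ends.
      chain : ∀ x xs → Linked Gap (x ∷ xs) →
        α x + total (x ∷ xs) + cost x (final x xs) ≤ α (final x xs) + a (final x xs)
      chain x [] [-] = ℕ.≤-reflexive (trans (cong₂ _+_ (cong (α x +_) (ℕ.+-identityʳ (a x))) (cost-refl x))
          (ℕ.+-identityʳ _))
      chain x (y ∷ ys) (gap ∷ gaps) = begin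
        α x + (a x + total (y ∷ ys)) + cost x z
          ≤⟨ ℕ.+-monoʳ-≤ (α x + (a x + total (y ∷ ys))) (cost-triangle x y z) ⟩
        α x + (a x + total (y ∷ ys)) + (cost x y + cost y z)
          ≡⟨ regroup (α x) (a x) (total (y ∷ ys)) (cost x y) (cost y z) ⟩
        α x + a x + cost x y + total (y ∷ ys) + cost y z
          ≤⟨ ℕ.+-monoˡ-≤ (cost y z) (ℕ.+-monoˡ-≤ (total (y ∷ ys)) gap) ⟩
        α y + total (y ∷ ys) + cost y z
          ≤⟨ chain y ys gaps ⟩
        α z + a z ∎
        where
        z = final y ys
        regroup : ∀ u v t c d → u + (v + t) + (c + d) ≡ u + v + c + t + d
        regroup = ℕ-Solver.solve-∀

      -- The costs before `u` are dropped, so that the cost from an inner entry (later `r`) to the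
      -- end survives.
      chain-through : ∀ x xs {u} → u ∈ x ∷ xs → Linked Gap (x ∷ xs) →
        α x + total (x ∷ xs) + cost u (final x xs) ≤ α (final x xs) + a (final x xs)
      chain-through x xs (here refl) gaps = chain x xs gaps
      chain-through x (y ∷ ys) {u} (there u∈) (gap ∷ gaps) = begin
        α x + (a x + total (y ∷ ys)) + cost u z
          ≡⟨ cong (_+ cost u z) (sym (ℕ.+-assoc (α x) (a x) _)) ⟩
        α x + a x + total (y ∷ ys) + cost u z
          ≤⟨ ℕ.+-monoˡ-≤ (cost u z) (ℕ.+-monoˡ-≤ (total (y ∷ ys)) (ℕ.≤-trans (ℕ.m≤m+n (α x + a x) (cost x y)) gap)) ⟩
        α y + total (y ∷ ys) + cost u z
          ≤⟨ chain-through y ys u∈ gaps ⟩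
        α z + a z ∎
        where z = final y ys

      -- The chain bound from `y` onwards leaves `α y` no room above `α x + a x`, which the gap
      -- already demands. So each gap is an equality, and in particular no descent of `p` is paid
      -- for.
      no-slack : ∀ x xs → Linked Gap (x ∷ xs) →
        α (final x xs) + a (final x xs) ≤ α x + total (x ∷ xs) →
        Prefix α (α x) (x ∷ xs) × Linked (λ i j → p i ≤ p j) (x ∷ xs)
      no-slack x [] _ _ = refl ∷ [] , [-]
      no-slack x (y ∷ ys) (gap ∷ gaps) tight = refl ∷ subst (λ A → Prefix α A (y ∷ ys)) αy
          (proj₁ rec) , χ<-zero no-cost ∷ proj₂ rec
        where
        upper : α y ≤ α x + a x
        upper = ℕ.+-cancelʳ-≤ (total (y ∷ ys)) _ _ (ℕ.≤-trans (ℕ.≤-trans (ℕ.m≤m+n _ _) (chain y ys gaps))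
          (ℕ.≤-trans tight (ℕ.≤-reflexive (sym (ℕ.+-assoc (α x) (a x) _)))))
        αy : α y ≡ α x + a x
        αy = ℕ.≤-antisym upper (ℕ.≤-trans (ℕ.m≤m+n _ _) gap)
        no-cost : χ (p y <ᵇ p x) ≡ 0
        no-cost = ℕ.n≤0⇒n≡0 (ℕ.≤-trans (χ≤cost x y) (ℕ.+-cancelˡ-≤ (α x + a x) _ _
          (ℕ.≤-trans gap (ℕ.≤-trans upper (ℕ.≤-reflexive (sym (ℕ.+-identityʳ _)))))))
        rec = no-slack y ys gaps (ℕ.≤-trans tight (ℕ.≤-reflexive
          (trans (sym (ℕ.+-assoc (α x) (a x) _)) (cong (_+ total (y ∷ ys)) (sym αy)))))

      -- Somewhere between `r` and a last entry in `M` a cost of 2 is due, but the box grants only 1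
      -- beyond the total.
      final∉M : ∀ x xs → M (final x xs) ≡ true → r ∈ x ∷ xs → Linked Gap (x ∷ xs) →
        α (final x xs) + a (final x xs) ≤ total (x ∷ xs) + 1 → ⊥
      final∉M x xs Mz r∈ gaps bound = ℕ.1+n≰n (ℕ.+-cancelˡ-≤ (total (x ∷ xs)) 2 1 (begin
        total (x ∷ xs) + 2 ≡⟨ cong (total (x ∷ xs) +_) (sym (cost-rM Mz)) ⟩
        total (x ∷ xs) + cost r z ≤⟨ ℕ.+-monoˡ-≤ (cost r z) (ℕ.m≤n+m _ (α x)) ⟩
        α x + total (x ∷ xs) + cost r z ≤⟨ chain-through x xs r∈ gaps ⟩
        α z + a z ≤⟨ bound ⟩
        total (x ∷ xs) + 1 ∎))
        where z = final x xs

      tight-prefix : ∀ l → r ∈ l → Linked Gap l → (∀ i → α i + a i ≤ total l + χ (M i)) →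
        Prefix α 0 l × Linked (λ i j → p i ≤ p j) l
      tight-prefix (x ∷ xs) r∈ gaps bound with M (final x xs) in Mz | bound (final x xs)
      ... | true | b = ⊥-elim (final∉M x xs Mz r∈ gaps b)
      ... | false | b = subst (λ A → Prefix α A (x ∷ xs)) αx (proj₁ res) , proj₂ res
        where
        b′ : α (final x xs) + a (final x xs) ≤ total (x ∷ xs)
        b′ = ℕ.≤-trans b (ℕ.≤-reflexive (ℕ.+-identityʳ _))
        αx : α x ≡ 0
        αx = ℕ.n≤0⇒n≡0 (ℕ.+-cancelʳ-≤ (total (x ∷ xs)) _ _ (ℕ.≤-trans (ℕ.m≤m+n _ _) (ℕ.≤-trans (chain x xs gaps) b′)))
        res = no-slack x xs gaps (ℕ.≤-trans b′ (ℕ.m≤n+m _ (α x)))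

      -- The lexicographic order by (α, p) in one number: `p` never exceeds `p r`, so `suc (p r)`
      -- serves as the base.
      key : Fin n → ℕ
      key i = α i * suc (p r) + p i

      p≤pr : ∀ i → p i ≤ p r
      p≤pr i with i Fin.≟ r
      ... | yes refl = ℕ.≤-refl
      ... | no i≢r = ℕ.<⇒≤ (r-top i≢r)

      key-≤ : ∀ {i j} → key i ≤ key j → i ≢ j → α i + χ (p j <ᵇ p i) ≤ α j
      key-≤ {i} {j} le i≢j with ℕ.<-cmp (α i) (α j)
      ... | tri< lt _ _ = ℕ.≤-trans (ℕ.+-monoʳ-≤ (α i) (χ≤1 _)) (ℕ.≤-trans (ℕ.≤-reflexive (ℕ.+-comm (α i) 1)) lt)
      ... | tri≈ _ eq _ = ℕ.≤-reflexive (trans (cong (α i +_) (χ<-no (ℕ.+-cancelˡ-≤ (α i * suc (p r)) _ _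
            (ℕ.≤-trans le (ℕ.≤-reflexive (cong (λ t → t * suc (p r) + p j) (sym eq))))))) (trans (ℕ.+-identityʳ _) eq))
      ... | tri> _ _ gt = contradiction (begin-strict
        key j <⟨ ℕ.+-monoʳ-< (α j * suc (p r)) (s≤s (p≤pr j)) ⟩
        α j * suc (p r) + suc (p r) ≡⟨ ℕ.+-comm _ (suc (p r)) ⟩
        suc (α j) * suc (p r) ≤⟨ ℕ.*-monoˡ-≤ (suc (p r)) gt ⟩
        α i * suc (p r) ≤⟨ ℕ.m≤m+n _ (p i) ⟩
        key i ∎) (ℕ.≤⇒≯ le)

      -- α makes a factor of the q-shifted factorial belonging to the ordered pair (i , j) vanish.
      Hit : Fin n → Fin n → Set
      Hit i j = ∃ λ k → k < a i + χ (M j ∧ (i ==F r)) × χ (p j <ᵇ p i) + α i + k ≡ α j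

      -- Sorting by `key` makes the difference of `α j` and `χ (p j <ᵇ p i) + α i` nonnegative. Were
      -- it below the exponent of the pair, it would be the index of a vanishing factor.
      no-hit⇒gap : ∀ {i j} → i ≢ j → ¬ Hit i j → key i ≤ key j → Gap i j
      no-hit⇒gap {i} {j} i≢j ¬hit le with a i + χ (M j ∧ (i ==F r)) ℕ.≤? α j ∸ (χ (p j <ᵇ p i) + α i)
      ... | yes big = begin
        α i + a i + (χ (p j <ᵇ p i) + χ (M j ∧ (i ==F r)))
          ≡⟨ regroup (α i) (a i) (χ (p j <ᵇ p i)) _ ⟩
        χ (p j <ᵇ p i) + α i + (a i + χ (M j ∧ (i ==F r)))
          ≤⟨ ℕ.+-monoʳ-≤ (χ (p j <ᵇ p i) + α i) big ⟩
        χ (p j <ᵇ p i) + α i + (α j ∸ (χ (p j <ᵇ p i) + α i))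
          ≡⟨ ℕ.m+[n∸m]≡n lower ⟩
        α j ∎
        where
        regroup : ∀ u v x y → u + v + (x + y) ≡ x + u + (v + y)
        regroup = ℕ-Solver.solve-∀
        lower : χ (p j <ᵇ p i) + α i ≤ α j
        lower = ℕ.≤-trans (ℕ.≤-reflexive (ℕ.+-comm (χ (p j <ᵇ p i)) (α i))) (key-≤ le i≢j)
      ... | no ¬big = contradiction (_ , ℕ.≰⇒> ¬big ,
              ℕ.m+[n∸m]≡n (ℕ.≤-trans (ℕ.≤-reflexive (ℕ.+-comm (χ (p j <ᵇ p i)) (α i))) (key-≤ le i≢j))) ¬hit

      no-hit⇒prefix : (∀ {i j} → i ≢ j → ¬ Hit i j) → (∀ i → α i + a i ≤ total (allFin n) + χ (M i)) →
        Prefix α 0 order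
      no-hit⇒prefix ¬hit bound = subst (Prefix α 0) same (proj₁ tight)
        where
        l = sortBy key (allFin n)
        l↭ = sortBy-↭ key (allFin n)
        tight = tight-prefix l (Perm.∈-resp-↭ (↭-sym l↭) (∈-allFin r))
          (linked-≢ (λ le i≢j → no-hit⇒gap i≢j (¬hit i≢j) le) (sortBy-↗ key (allFin n)) (unique-↭ (↭-sym l↭) (allFin⁺ n)))
          (λ i → ℕ.≤-trans (bound i) (ℕ.≤-reflexive (cong (_+ χ (M i)) (total-↭ (↭-sym l↭)))))
        -- Having no descents, the list sorted by `key` is sorted by the injective `p` as well.
        same : l ≡ order
        same = sorted-unique p p-inj (↭-trans l↭ (↭-sym (sortBy-↭ p (allFin n)))) (proj₂ tight) (sortBy-↗ p (allFin n))

  -- Exponent vectors and degree bounds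

  sumℤ : ∀ {n} → (Fin n → ℤ) → ℤ
  sumℤ {zero} v = 0ℤ
  sumℤ {suc n} v = v Fin.zero ℤ.+ sumℤ (v ∘ Fin.suc)

  dot : ∀ {n} → (Fin n → ℤ) → (Fin n → ℤ) → ℤ
  dot β v = sumℤ (λ i → β i ℤ.* v i)

  allZero⇒ : ∀ {n} (v : Fin n → ℤ) → allZero v ≡ true → ∀ i → v i ≡ 0ℤ
  allZero⇒ {suc n} v eq i with v Fin.zero ℤ.≟ 0ℤ
  allZero⇒ {suc n} v eq Fin.zero | yes v0 = v0
  allZero⇒ {suc n} v eq (Fin.suc i) | yes v0 = allZero⇒ (v ∘ Fin.suc) eq i

  allZero⇐ : ∀ {n} (v : Fin n → ℤ) → (∀ i → v i ≡ 0ℤ) → allZero v ≡ true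
  allZero⇐ {zero} v eq = refl
  allZero⇐ {suc n} v eq = cong₂ _∧_ (dec-true (v Fin.zero ℤ.≟ 0ℤ) (eq Fin.zero)) (allZero⇐ (v ∘ Fin.suc) (eq ∘ Fin.suc))

  sumℤ-nonneg : ∀ {n} (v : Fin n → ℤ) → (∀ i → 0ℤ ℤ.≤ v i) → 0ℤ ℤ.≤ sumℤ v
  sumℤ-nonneg {zero} v v≥0 = ℤ.≤-refl
  sumℤ-nonneg {suc n} v v≥0 = ℤ.+-mono-≤ (v≥0 Fin.zero) (sumℤ-nonneg (v ∘ Fin.suc) (v≥0 ∘ Fin.suc))

  nonneg-sum-zero : ∀ {x y} → 0ℤ ℤ.≤ x → 0ℤ ℤ.≤ y → x ℤ.+ y ≡ 0ℤ → x ≡ 0ℤ × y ≡ 0ℤ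
  nonneg-sum-zero {pos zero} {pos zero} _ _ eq = refl , refl

  sumℤ-zero : ∀ {n} (v : Fin n → ℤ) → (∀ i → 0ℤ ℤ.≤ v i) → sumℤ v ≡ 0ℤ → ∀ i → v i ≡ 0ℤ
  sumℤ-zero {suc n} v v≥0 eq i with nonneg-sum-zero (v≥0 Fin.zero) (sumℤ-nonneg (v ∘ Fin.suc) (v≥0 ∘ Fin.suc)) eq
  sumℤ-zero {suc n} v v≥0 eq Fin.zero | e , _ = e
  sumℤ-zero {suc n} v v≥0 eq (Fin.suc i) | _ , e = sumℤ-zero (v ∘ Fin.suc) (v≥0 ∘ Fin.suc) e i

  sumℤ-cong : ∀ {n} {u v : Fin n → ℤ} → (∀ i → u i ≡ v i) → sumℤ u ≡ sumℤ v
  sumℤ-cong {zero} eq = refl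
  sumℤ-cong {suc n} eq = cong₂ ℤ._+_ (eq Fin.zero) (sumℤ-cong (eq ∘ Fin.suc))

  sumℤ-0 : ∀ n → sumℤ {n} (λ _ → 0ℤ) ≡ 0ℤ
  sumℤ-0 zero = refl
  sumℤ-0 (suc n) = trans (ℤ.+-identityˡ _) (sumℤ-0 n)

  ℤ-interchange : ∀ a b c d → (a ℤ.+ b) ℤ.+ (c ℤ.+ d) ≡ (a ℤ.+ c) ℤ.+ (b ℤ.+ d)
  ℤ-interchange = ℤ-Solver.solve-∀

  sumℤ-+ : ∀ {n} (u v : Fin n → ℤ) → sumℤ (λ i → u i ℤ.+ v i) ≡ sumℤ u ℤ.+ sumℤ v
  sumℤ-+ {zero} u v = refl
  sumℤ-+ {suc n} u v = trans (cong (λ t → (u Fin.zero ℤ.+ v Fin.zero) ℤ.+ t) (sumℤ-+ (u ∘ Fin.suc) (v ∘ Fin.suc)))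
    (ℤ-interchange (u Fin.zero) (v Fin.zero) _ _)

  sumℤ-neg : ∀ {n} (u : Fin n → ℤ) → sumℤ (λ i → ℤ.- u i) ≡ ℤ.- sumℤ u
  sumℤ-neg {zero} u = refl
  sumℤ-neg {suc n} u = trans (cong (λ t → (ℤ.- u Fin.zero) ℤ.+ t) (sumℤ-neg (u ∘ Fin.suc))) (sym
      (ℤ.neg-distrib-+ (u Fin.zero) _))

  dot-+ : ∀ {n} (β u v : Fin n → ℤ) → dot β (addVec u v) ≡ dot β u ℤ.+ dot β v
  dot-+ β u v = trans (sumℤ-cong (λ i → ℤ.*-distribˡ-+ (β i) (u i) (v i))) (sumℤ-+ (λ i → β i ℤ.* u i) (λ i → β i ℤ.* v i))

  dot-0 : ∀ {n} (β : Fin n → ℤ) → dot β zeroVec ≡ 0ℤ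
  dot-0 {n} β = trans (sumℤ-cong (λ i → ℤ.*-zeroʳ (β i))) (sumℤ-0 n)

  -- Total degree 0 gives every nonconstant monomial a negative exponent, so lower bounds are what
  -- the interpolation has to control.
  Bounded : ∀ {n} → (Fin n → ℕ) → Term n → Set
  Bounded d (term _ _ v) = sumℤ v ≡ 0ℤ × ∀ i → ℤ.- pos (d i) ℤ.≤ v i

  -- Pairs by position in the list instead of by index, so that a product over pairs can follow a
  -- permutation of the list.
  upairs : ∀ {A : Set} → List A → List (A × A)
  upairs [] = []
  upairs (x ∷ xs) = map (x ,_) xs ++ upairs xs

  private
    module _ {n : ℕ} where
      row : Fin n → List (Fin n) → List (Fin n × Fin n)
      row i = concatMap (λ j → if toℕ i <ᵇ toℕ j then (i , j) ∷ [] else [])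

      row-above : ∀ i {l} → All (λ j → toℕ i < toℕ j) l → row i l ≡ map (i ,_) l
      row-above i [] = refl
      row-above i (_∷_ {j} lt lts) rewrite dec-true (toℕ i ℕ.<? toℕ j) lt = cong ((i , j) ∷_) (row-above i lts)

      row-below : ∀ i j l → toℕ j ≤ toℕ i → row i (j ∷ l) ≡ row i l
      row-below i j l le rewrite dec-false (toℕ i ℕ.<? toℕ j) (ℕ.≤⇒≯ le) = refl

      rows-below : ∀ x xs {l} → All (λ i → toℕ x < toℕ i) l →
        concatMap (λ i → row i (x ∷ xs)) l ≡ concatMap (λ i → row i xs) l
      rows-below x xs [] = refl
      rows-below x xs (_∷_ {i} lt lts) = cong₂ _++_ (row-below i x xs (ℕ.<⇒≤ lt)) (rows-below x xs lts)

      increasing-pairs : ∀ {l} → AllPairs (λ i j → toℕ i < toℕ j) l → concatMap (λ i → row i l) l ≡ upairs l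
      increasing-pairs [] = refl
      increasing-pairs (_∷_ {x} {xs} lts incr) = cong₂ _++_
        (trans (row-below x x xs ℕ.≤-refl) (row-above x lts))
        (trans (rows-below x xs lts) (increasing-pairs incr))

  allFin-increasing : ∀ n → AllPairs (λ i j → toℕ i < toℕ j) (allFin n)
  allFin-increasing n = AllPairs.tabulate⁺-< (λ lt → lt)

  pairs≡upairs : ∀ n → pairs n ≡ upairs (allFin n)
  pairs≡upairs n = increasing-pairs (allFin-increasing n)

  upairs-All : ∀ {A : Set} {R : A → A → Set} {l} → AllPairs R l → All (λ { (x , y) → R x y }) (upairs l)
  upairs-All [] = []
  upairs-All (Rs ∷ Rss) = All.++⁺ (All.map⁺ Rs) (upairs-All Rss)

  All-*P : ∀ {n} {A B C : Term n → Set} → (∀ s t → A s → B t → C (termMul s t)) →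
    ∀ {P P′} → All A P → All B P′ → All C (P *P P′)
  All-*P f [] _ = []
  All-*P f (_∷_ {s} a as) bs = All.++⁺ (All.map⁺ (All.map (λ {t} → f s t a) bs)) (All-*P f as bs)

  -- A copy of the factor local to `LHSprod`, with the exponents abstracted to `S`.
  pairFactor : ∀ {n} → (Fin n → Fin n → ℕ) → Fin n × Fin n → Poly n
  pairFactor S (i , j) = poch 0 (ratio i j) (S i j) *P poch 1 (ratio j i) (S j i)

  sumℤ-δ : ∀ {n} (β : Fin n → ℤ) i → sumℤ (λ k → β k ℤ.* (if k ==F i then 1ℤ else 0ℤ)) ≡ β i
  sumℤ-δ {suc n} β Fin.zero = trans (cong₂ ℤ._+_ (ℤ.*-identityʳ (β Fin.zero))
    (trans (sumℤ-cong (λ k → ℤ.*-zeroʳ (β (Fin.suc k)))) (sumℤ-0 n))) (ℤ.+-identityʳ _)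
  sumℤ-δ {suc n} β (Fin.suc i) = trans (cong₂ ℤ._+_ (ℤ.*-zeroʳ (β Fin.zero)) (sumℤ-δ (β ∘ Fin.suc) i)) (ℤ.+-identityˡ _)

  dot-ratio : ∀ {n} (β : Fin n → ℤ) i j → dot β (ratio i j) ≡ β i ℤ.- β j
  dot-ratio β i j = trans (sumℤ-cong (λ k → trans (ℤ.*-distribˡ-+ (β k) (δ i k) (ℤ.- δ j k)) (cong (λ t →
      (β k ℤ.* δ i k) ℤ.+ t) (sym (ℤ.neg-distribʳ-* (β k) (δ j k))))))
    (trans (sumℤ-+ (λ k → β k ℤ.* δ i k) (λ k → ℤ.- (β k ℤ.* δ j k)))
      (cong₂ ℤ._+_ (sumℤ-δ β i) (trans (sumℤ-neg (λ k → β k ℤ.* δ j k)) (cong ℤ.-_ (sumℤ-δ β j)))))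
    where
    δ : ∀ i k → ℤ
    δ i k = if k ==F i then 1ℤ else 0ℤ

  sumℤ-ratio : ∀ {n} (i j : Fin n) → sumℤ (ratio i j) ≡ 0ℤ
  sumℤ-ratio i j = trans (sumℤ-cong (λ k → sym (ℤ.*-identityˡ (ratio i j k)))) (dot-ratio (λ _ → 1ℤ) i j)

  Bounded-mul : ∀ {n} {d d′ : Fin n → ℕ} s t → Bounded d s → Bounded d′ t → Bounded (λ i → d i + d′ i) (termMul s t)
  Bounded-mul {d = d} {d′} (term _ _ u) (term _ _ v) (su , lu) (sv , lv) =
    trans (sumℤ-+ u v) (cong₂ ℤ._+_ su sv) ,
    λ i → ℤ.≤-trans (ℤ.≤-reflexive (ℤ.neg-distrib-+ (pos (d i)) (pos (d′ i)))) (ℤ.+-mono-≤ (lu i) (lv i))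

  Bounded-mono : ∀ {n} {d d′ : Fin n → ℕ} → (∀ i → d i ≤ d′ i) → ∀ {t} → Bounded d t → Bounded d′ t
  Bounded-mono le {term _ _ v} (sv , lv) = sv , λ i → ℤ.≤-trans (ℤ.neg-mono-≤ (ℤ.+≤+ (le i))) (lv i)

  Bounded-one : ∀ {n} (d : Fin n → ℕ) c e → Bounded d (term c e zeroVec)
  Bounded-one {n} d _ _ = sumℤ-0 n , λ i → ℤ.neg-≤-pos

  Bounded-prodP : ∀ {n} {A : Set} (D : A → Fin n → ℕ) (f : A → Poly n) → (∀ x → All (Bounded (D x)) (f x)) →
    ∀ l → All (Bounded (λ u → sum (map (λ x → D x u) l))) (prodP f l)
  Bounded-prodP D f bd [] = Bounded-one (λ _ → 0) 1ℤ 0 ∷ []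
  Bounded-prodP D f bd (x ∷ l) = All-*P (λ s t → Bounded-mul s t) (bd x) (Bounded-prodP D f bd l)

  sum-const : ∀ {A : Set} c (l : List A) → sum (map (λ _ → c) l) ≡ length l ℕ.* c
  sum-const c [] = refl
  sum-const c (x ∷ l) = cong (c +_) (sum-const c l)

  Bounded-poch : ∀ {n} e (i j : Fin n) k → All (Bounded (λ u → if u ==F j then k else 0)) (poch e (ratio i j) k)
  Bounded-poch {n} e i j k = All.map (λ {t} → Bounded-mono total {t}) (Bounded-prodP (λ _ → D) _ factor (upTo k))
    where
    D : Fin n → ℕ
    D u = if u ==F j then 1 else 0
    low : ∀ u → ℤ.- pos (D u) ℤ.≤ ratio i j u
    low u with u ==F i | u ==F j
    ... | true | true = ℤ.-≤+
    ... | true | false = ℤ.+≤+ z≤n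
    ... | false | true = ℤ.≤-refl
    ... | false | false = ℤ.≤-refl
    factor : ∀ l → All (Bounded D) (1P -P mono (e + l) (ratio i j))
    factor l = Bounded-one D 1ℤ 0 ∷ (sumℤ-ratio i j , low) ∷ []
    total : ∀ u → sum (map (λ _ → D u) (upTo k)) ≤ (if u ==F j then k else 0)
    total u with u ==F j
    ... | true = ℕ.≤-reflexive (trans (sum-const 1 (upTo k)) (trans (ℕ.*-identityʳ _) (length-upTo k)))
    ... | false = ℕ.≤-reflexive (trans (sum-const 0 (upTo k)) (ℕ.*-zeroʳ (length (upTo k))))

  module Degrees {n : ℕ} (S : Fin n → Fin n → ℕ) (u : Fin n) where

    [_] : Fin n → ℕ → ℕ
    [ j ] c = if u ==F j then c else 0

    -- How far one pair can lower the exponent of x_u: powers of x_i/x_j lower x_j by at most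
    -- `S i j`, those of x_j/x_i lower x_i by at most `S j i`.
    pairDegree : Fin n × Fin n → ℕ
    pairDegree (i , j) = [ j ] (S i j) + [ i ] (S j i)

    self : ∀ c → [ u ] c ≡ c
    self c = cong (if_then c else 0) (==F-refl u)

    other : ∀ {j} → u ≢ j → ∀ c → [ j ] c ≡ 0
    other u≢j c = cong (if_then c else 0) (==F-≢ u≢j)

    δ-absent : ∀ (c : Fin n → ℕ) l → All (u ≢_) l → sum (map (λ j → [ j ] (c j)) l) ≡ 0
    δ-absent c [] [] = refl
    δ-absent c (j ∷ l) (u≢ ∷ us) = cong₂ _+_ (other u≢ (c j)) (δ-absent c l us)

    δ-present : ∀ (c : Fin n → ℕ) l → Unique l → u ∈ l → sum (map (λ j → [ j ] (c j)) l) ≡ c u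
    δ-present c (j ∷ l) (us ∷ _) (here refl) = trans (cong₂ _+_ (self (c u)) (δ-absent c l us)) (ℕ.+-identityʳ _)
    δ-present c (j ∷ l) (js ∷ uniq) (there u∈) = cong₂ _+_ (other (λ e → All.lookup js u∈ (sym e)) (c j))
        (δ-present c l uniq u∈)

    sum-pairs-∷ : ∀ x xs → sum (map pairDegree (upairs (x ∷ xs))) ≡
      sum (map (λ j → pairDegree (x , j)) xs) + sum (map pairDegree (upairs xs))
    sum-pairs-∷ x xs = trans (cong sum (map-++ pairDegree (map (x ,_) xs) (upairs xs)))
      (trans (sum-++ (map pairDegree (map (x ,_) xs)) _) (cong (λ l → sum l + sum (map pairDegree
          (upairs xs))) (sym (map-∘ xs))))

    sum-cong-All : ∀ {f g : Fin n → ℕ} {l} → All (λ j → f j ≡ g j) l → sum (map f l) ≡ sum (map g l)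
    sum-cong-All [] = refl
    sum-cong-All (e ∷ es) = cong₂ _+_ e (sum-cong-All es)

    row-absent : ∀ x xs → u ≢ x → sum (map (λ j → pairDegree (x , j)) xs) ≡ sum (map (λ j → [ j ] (S x j)) xs)
    row-absent x xs u≢x = sum-cong-All (All.universal (λ j → trans (cong ([ j ] (S x j) +_) (other u≢x
        (S j x))) (ℕ.+-identityʳ _)) xs)

    pairs-absent : ∀ l → All (u ≢_) l → sum (map pairDegree (upairs l)) ≡ 0
    pairs-absent [] [] = refl
    pairs-absent (x ∷ xs) (u≢x ∷ us) = trans (sum-pairs-∷ x xs)
      (cong₂ _+_ (trans (row-absent x xs u≢x) (δ-absent (S x) xs us)) (pairs-absent xs us))

    -- Every other index i meets `u` in exactly one pair and contributes `S i u`, whichever of the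
    -- two comes first. The diagonal entry completes the column sum.
    pairs-present : ∀ l → Unique l → u ∈ l → sum (map pairDegree (upairs l)) + S u u ≡ sum (map (λ i → S i u) l)
    pairs-present (x ∷ xs) (us ∷ _) (here refl) = begin
      sum (map pairDegree (upairs (x ∷ xs))) + S x x
        ≡⟨ cong (_+ S x x) (trans (sum-pairs-∷ x xs) (cong₂ _+_ (sum-cong-All (All.map (λ {j} u≢j → cong₂ _+_
            (other u≢j (S x j)) (self (S j x))) us)) (pairs-absent xs us))) ⟩
      sum (map (λ j → S j x) xs) + 0 + S x x
        ≡⟨ trans (cong (_+ S x x) (ℕ.+-identityʳ _)) (ℕ.+-comm _ (S x x)) ⟩
      S x x + sum (map (λ j → S j x) xs) ∎
      where open ≡-Reasoning
    pairs-present (x ∷ xs) (xs≢ ∷ uniq) (there u∈) = begin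
      sum (map pairDegree (upairs (x ∷ xs))) + S u u
        ≡⟨ cong (_+ S u u) (trans (sum-pairs-∷ x xs) (cong (_+ sum (map pairDegree (upairs xs)))
             (trans (row-absent x xs (λ e → All.lookup xs≢ u∈ (sym e))) (δ-present (S x) xs uniq u∈)))) ⟩
      S x u + sum (map pairDegree (upairs xs)) + S u u
        ≡⟨ ℕ.+-assoc (S x u) _ (S u u) ⟩
      S x u + (sum (map pairDegree (upairs xs)) + S u u)
        ≡⟨ cong (S x u +_) (pairs-present xs uniq u∈) ⟩
      S x u + sum (map (λ i → S i u) xs) ∎
      where open ≡-Reasoning

  -- The cyclic order that starts after `r`

  module Cyclic {n : ℕ} (m : ℕ) (m<n : m < n) (r : Fin n) where

    -- Only the order of the values matters: r+1, …, n, 1, …, r.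
    p : Fin n → ℕ
    p j = if toℕ r <ᵇ toℕ j then toℕ j else toℕ j + n

    -- Replacing x_j by q x_j for j ≤ r moves the extra factor q so that the product is ordered by p.
    shift : Fin n → ℤ
    shift j = if toℕ r <ᵇ toℕ j then 0ℤ else 1ℤ

    data Side (j : Fin n) : Set where
      above : toℕ r < toℕ j → p j ≡ toℕ j → shift j ≡ 0ℤ → Side j
      below : toℕ j ≤ toℕ r → p j ≡ toℕ j + n → shift j ≡ 1ℤ → Side j

    side : ∀ j → Side j
    side j with toℕ r ℕ.<? toℕ j
    ... | yes lt = above lt (cong (if_then toℕ j else toℕ j + n) (dec-true (toℕ r ℕ.<? toℕ j) lt))
                            (cong (if_then 0ℤ else 1ℤ) (dec-true (toℕ r ℕ.<? toℕ j) lt))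
    ... | no ¬lt = below (ℕ.≮⇒≥ ¬lt) (cong (if_then toℕ j else toℕ j + n) (dec-false (toℕ r ℕ.<? toℕ j) ¬lt))
                            (cong (if_then 0ℤ else 1ℤ) (dec-false (toℕ r ℕ.<? toℕ j) ¬lt))

    p-above<below : ∀ i j → p i ≡ toℕ i → p j ≡ toℕ j + n → p i < p j
    p-above<below i j pi pj = subst₂ _<_ (sym pi) (sym pj) (ℕ.<-≤-trans (Fin.toℕ<n i) (ℕ.m≤n+m n (toℕ j)))

    p-inj : ∀ {i j} → p i ≡ p j → i ≡ j
    p-inj {i} {j} eq with side i | side j
    ... | above _ pi _ | above _ pj _ = Fin.toℕ-injective (trans (sym pi) (trans eq pj))
    ... | above _ pi _ | below _ pj _ = contradiction eq (ℕ.<⇒≢ (p-above<below i j pi pj))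
    ... | below _ pi _ | above _ pj _ = contradiction (sym eq) (ℕ.<⇒≢ (p-above<below j i pj pi))
    ... | below _ pi _ | below _ pj _ = Fin.toℕ-injective (ℕ.+-cancelʳ-≡ n _ _ (trans (sym pi) (trans eq pj)))

    p-r : p r ≡ toℕ r + n
    p-r with side r
    ... | above lt _ _ = contradiction lt (ℕ.<-irrefl refl)
    ... | below _ eq _ = eq

    r-top : ∀ {i} → i ≢ r → p i < p r
    r-top {i} i≢r with side i
    ... | above _ pi _ = p-above<below i r pi p-r
    ... | below le pi _ = subst₂ _<_ (sym pi) (sym p-r) (ℕ.+-monoˡ-< n (ℕ.≤∧≢⇒< le (i≢r ∘ Fin.toℕ-injective)))

    r<p : ∀ j → toℕ r < p j
    r<p j with side j
    ... | above lt pj _ = subst (toℕ r <_) (sym pj) lt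
    ... | below _ pj _ = subst (toℕ r <_) (sym pj) (ℕ.<-≤-trans (Fin.toℕ<n r) (ℕ.m≤n+m n (toℕ j)))

    cdist-self : cdist r r ≡ 0
    cdist-self = trans (cong (if_then toℕ r ∸ toℕ r else (toℕ r + n) ∸ toℕ r) (dec-true
        (toℕ r ℕ.≤? toℕ r) ℕ.≤-refl)) (ℕ.n∸n≡0 (toℕ r))

    cdist-p : ∀ {j} → j ≢ r → cdist r j ≡ p j ∸ toℕ r
    cdist-p {j} j≢r with side j
    ... | above lt pj _ = trans (cong (if_then toℕ j ∸ toℕ r else (toℕ j + n) ∸ toℕ r) (dec-true
        (toℕ r ℕ.≤? toℕ j) (ℕ.<⇒≤ lt)))
                            (cong (_∸ toℕ r) (sym pj))
    ... | below le pj _ = trans (cong (if_then toℕ j ∸ toℕ r else (toℕ j + n) ∸ toℕ r)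
                              (dec-false (toℕ r ℕ.≤? toℕ j) (λ ge → j≢r (Fin.toℕ-injective (ℕ.≤-antisym le ge)))))
                            (cong (_∸ toℕ r) (sym pj))

    M : Fin n → Bool
    M = inM m r

    -- For j other than `r`, the cyclic distance from `r` is `p j ∸ toℕ r` and is positive. At `r`
    -- the distance is 0 while `p r` exceeds `toℕ r` by n > m, so both sides are false.
    M≡ : ∀ j → M j ≡ (p j ≤ᵇ toℕ r + m)
    M≡ j with j Fin.≟ r
    ... | yes refl = trans (cong (λ c → (1 ≤ᵇ c) ∧ (c ≤ᵇ m)) cdist-self)
          (sym (dec-false (p r ℕ.≤? toℕ r + m) (λ le → ℕ.<⇒≱ m<n (ℕ.+-cancelˡ-≤ (toℕ r) n m (subst (_≤ toℕ r + m) p-r le)))))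
    ... | no j≢r = trans (cong (λ c → (1 ≤ᵇ c) ∧ (c ≤ᵇ m)) (cdist-p j≢r))
          (trans (cong (_∧ (p j ∸ toℕ r ≤ᵇ m)) (dec-true (1 ℕ.≤? p j ∸ toℕ r) (ℕ.m<n⇒0<n∸m (r<p j)))) compare)
      where
      compare : (p j ∸ toℕ r ≤ᵇ m) ≡ (p j ≤ᵇ toℕ r + m)
      compare with p j ℕ.≤? toℕ r + m
      ... | yes le = trans (dec-true (p j ∸ toℕ r ℕ.≤? m) (ℕ.m≤n+o⇒m∸n≤o (p j) (toℕ r) le)) (sym (dec-true
          (p j ℕ.≤? toℕ r + m) le))
      ... | no ¬le = trans (dec-false (p j ∸ toℕ r ℕ.≤? m) (λ le → ¬le (ℕ.≤-trans (ℕ.m≤n+m∸n (p j) (toℕ r))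
          (ℕ.+-monoʳ-≤ (toℕ r) le)))) (sym (dec-false (p j ℕ.≤? toℕ r + m) ¬le))

    M⇒≤ : ∀ {j} → M j ≡ true → p j ≤ toℕ r + m
    M⇒≤ {j} Mj with p j ℕ.≤? toℕ r + m
    ... | yes le = le
    ... | no ¬le with () ← trans (sym Mj) (trans (M≡ j) (dec-false (p j ℕ.≤? toℕ r + m) ¬le))

    ¬M⇒> : ∀ {j} → M j ≡ false → toℕ r + m < p j
    ¬M⇒> {j} Mj with p j ℕ.≤? toℕ r + m
    ... | no ¬le = ℕ.≰⇒> ¬le
    ... | yes le with () ← trans (sym Mj) (trans (M≡ j) (dec-true (p j ℕ.≤? toℕ r + m) le))

    M-initial : ∀ {i j} → M i ≡ true → M j ≡ false → p i < p j
    M-initial Mi Mj = ℕ.≤-<-trans (M⇒≤ Mi) (¬M⇒> Mj)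

    r∉M : M r ≡ false
    r∉M = cong (λ c → (1 ≤ᵇ c) ∧ (c ≤ᵇ m)) cdist-self

    -- After the translation by `shift`, the additional q of a pair sits with whichever ordered pair
    -- descends along `p`. The two halves of a pair factor thereby take the same form, and the
    -- product over pairs becomes symmetric.
    offset : ∀ {i j} → toℕ i < toℕ j →
      shift i ℤ.- shift j ≡ pos (χ (p j <ᵇ p i)) × 1ℤ ℤ.+ (shift j ℤ.- shift i) ≡ pos (χ (p i <ᵇ p j))
    offset {i} {j} lt with side i | side j
    ... | above _ pi si | above _ pj sj rewrite si | sj
        | χ<-yes {p i} {p j} (subst₂ _<_ (sym pi) (sym pj) lt)
        | χ<-no {p j} {p i} (subst₂ _≤_ (sym pi) (sym pj) (ℕ.<⇒≤ lt)) = refl , refl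
    ... | below _ pi si | below _ pj sj rewrite si | sj
        | χ<-yes {p i} {p j} (subst₂ _<_ (sym pi) (sym pj) (ℕ.+-monoˡ-< n lt))
        | χ<-no {p j} {p i} (subst₂ _≤_ (sym pi) (sym pj) (ℕ.+-monoˡ-≤ n (ℕ.<⇒≤ lt))) = refl , refl
    ... | above ri _ _ | below jr _ _ = contradiction (ℕ.<-trans ri lt) (ℕ.≤⇒≯ jr)
    ... | below _ pi si | above _ pj sj rewrite si | sj
        | χ<-yes (p-above<below j i pj pi)
        | χ<-no {p i} {p j} (ℕ.<⇒≤ (p-above<below j i pj pi)) = refl , refl

  module _ {n : ℕ} (a : Fin n → ℕ) where
    open Prefixes a

    Prefix-cong : ∀ {α β A l} → All (λ i → α i ≡ β i) l → Prefix α A l → Prefix β A l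
    Prefix-cong [] [] = []
    Prefix-cong (e ∷ es) (αx ∷ pre) = trans (sym e) αx ∷ Prefix-cong es pre

    prefix-sums : ∀ A l → Unique l → ∃ λ α → Prefix α A l
    prefix-sums A [] [] = (λ _ → 0) , []
    prefix-sums A (x ∷ xs) (x≢ ∷ uniq) with prefix-sums (A + a x) xs uniq
    ... | α , pre = (λ i → if i ==F x then A else α i) ,
      cong (if_then A else α x) (==F-refl x) ∷
      Prefix-cong (All.map (λ {i} x≢i → sym (cong (if_then A else α i) (==F-≢ (x≢i ∘ sym)))) x≢) pre

open Combinatorics
open import Data.Rational using (_+_; _*_; -_; _-_)
open +-*-Solver using (solve; con; _:+_; _:*_; :-_; _:-_; _:=_)
open ≡-Reasoning

-- Interpolation at powers of q

swap-minus : ∀ x y → x ℤ.- y ≡ ℤ.- (y ℤ.- x)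
swap-minus x y = sym (trans (ℤ.neg-distrib-+ y (ℤ.- x)) (trans (cong (λ t → (ℤ.- y) ℤ.+ t)
    (ℤ.neg-involutive x)) (ℤ.+-comm (ℤ.- y) x)))

ι : ℤ → ℚ
ι z = z ℚ./ 1

private
  toℚᵘ-ι : ∀ z → ℚ.toℚᵘ (ι z) ℚᵘ.≃ ℚᵘ.mkℚᵘ z 0
  toℚᵘ-ι z = ℚ.toℚᵘ-fromℚᵘ (ℚᵘ.mkℚᵘ z 0)

ι-+ : ∀ x y → ι (x ℤ.+ y) ≡ ι x + ι y
ι-+ x y = ℚ.toℚᵘ-injective (ℚᵘ.≃-trans (toℚᵘ-ι (x ℤ.+ y)) (ℚᵘ.≃-trans (ℚᵘ.*≡* (eq x y))
  (ℚᵘ.≃-sym (ℚᵘ.≃-trans (ℚ.toℚᵘ-homo-+ (ι x) (ι y)) (ℚᵘ.+-cong (toℚᵘ-ι x) (toℚᵘ-ι y))))))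
  where
  eq : ∀ x y → (x ℤ.+ y) ℤ.* 1ℤ ≡ (x ℤ.* 1ℤ ℤ.+ y ℤ.* 1ℤ) ℤ.* 1ℤ
  eq x y = cong (ℤ._* 1ℤ) (sym (cong₂ ℤ._+_ (ℤ.*-identityʳ x) (ℤ.*-identityʳ y)))

ι-* : ∀ x y → ι (x ℤ.* y) ≡ ι x * ι y
ι-* x y = ℚ.toℚᵘ-injective (ℚᵘ.≃-trans (toℚᵘ-ι (x ℤ.* y)) (ℚᵘ.≃-sym
  (ℚᵘ.≃-trans (ℚ.toℚᵘ-homo-* (ι x) (ι y)) (ℚᵘ.*-cong (toℚᵘ-ι x) (toℚᵘ-ι y)))))

ι-neg : ∀ x → ι (ℤ.- x) ≡ - ι x
ι-neg x = ℚ.toℚᵘ-injective (ℚᵘ.≃-trans (toℚᵘ-ι (ℤ.- x)) (ℚᵘ.≃-sym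
  (ℚᵘ.≃-trans (ℚ.toℚᵘ-homo‿- (ι x)) (ℚᵘ.-‿cong (toℚᵘ-ι x)))))

ι-injective : ∀ {x y} → ι x ≡ ι y → x ≡ y
ι-injective {x} {y} eq with ℚᵘ.≃-trans (ℚᵘ.≃-sym (toℚᵘ-ι x)) (ℚᵘ.≃-trans (ℚᵘ.≃-reflexive (cong ℚ.toℚᵘ eq)) (toℚᵘ-ι y))
... | ℚᵘ.*≡* e = trans (sym (ℤ.*-identityʳ x)) (trans e (ℤ.*-identityʳ y))

infixr 8 _^_

_^_ : ℚ → ℕ → ℚ
x ^ zero = 1ℚ
x ^ suc n = x * x ^ n

^-+ : ∀ x m n → x ^ (m ℕ.+ n) ≡ x ^ m * x ^ n
^-+ x zero n = sym (ℚ.*-identityˡ _)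
^-+ x (suc m) n = trans (cong (x *_) (^-+ x m n)) (sym (ℚ.*-assoc x (x ^ m) (x ^ n)))

-- The inverse of q is a parameter, which makes integer powers of q available without division or
-- proofs that q is nonzero.
module Specialised (q Q : ℚ) (qQ : q * Q ≡ 1ℚ) where

  pw : ℤ → ℚ
  pw (pos n) = q ^ n
  pw -[1+ n ] = Q ^ suc n

  pw-⊖ : ∀ m n → pw (m ⊖ n) ≡ q ^ m * Q ^ n
  pw-⊖ m zero = sym (ℚ.*-identityʳ _)
  pw-⊖ zero (suc n) = sym (ℚ.*-identityˡ _)
  pw-⊖ (suc m) (suc n) = begin
    pw (suc m ⊖ suc n) ≡⟨ cong pw (ℤ.[1+m]⊖[1+n]≡m⊖n m n) ⟩
    pw (m ⊖ n) ≡⟨ pw-⊖ m n ⟩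
    q ^ m * Q ^ n ≡⟨ sym (ℚ.*-identityˡ _) ⟩
    1ℚ * (q ^ m * Q ^ n) ≡⟨ cong (_* (q ^ m * Q ^ n)) (sym qQ) ⟩
    q * Q * (q ^ m * Q ^ n) ≡⟨ solve 4 (λ a b c d → a :* b :* (c :* d) := a :* c :* (b :* d)) refl q Q (q ^ m) (Q ^ n) ⟩
    q ^ suc m * Q ^ suc n ∎

  pw-+ : ∀ x y → pw (x ℤ.+ y) ≡ pw x * pw y
  pw-+ (pos m) (pos n) = ^-+ q m n
  pw-+ (pos m) -[1+ n ] = pw-⊖ m (suc n)
  pw-+ -[1+ m ] (pos n) = trans (pw-⊖ n (suc m)) (ℚ.*-comm (q ^ n) (Q ^ suc m))
  pw-+ -[1+ m ] -[1+ n ] = trans (cong (λ k → Q * (Q ^ k)) (sym (ℕ.+-suc m n))) (^-+ Q (suc m) (suc n))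

  pw-neg : ∀ n → pw (ℤ.- pos n) ≡ Q ^ n
  pw-neg zero = refl
  pw-neg (suc n) = refl

  -- L d y = ∏_{k=1}^{d} (y − Q^k) = Σ_k w d k y^k.
  L : ℕ → ℚ → ℚ
  L zero y = 1ℚ
  L (suc d) y = L d y * (y - Q ^ suc d)

  L-vanish : ∀ d v → ℤ.- pos d ℤ.≤ v → v ℤ.< 0ℤ → L d (pw v) ≡ 0ℚ
  L-vanish d (pos _) _ (ℤ.+<+ ())
  L-vanish (suc d) -[1+ k ] (ℤ.-≤- k≤d) lt with k ℕ.≟ d
  ... | yes refl = trans (cong (L d (Q ^ suc k) *_) (ℚ.+-inverseʳ (Q ^ suc k))) (ℚ.*-zeroʳ (L d (Q ^ suc k)))
  ... | no k≢d = trans (cong (_* (Q ^ suc k - Q ^ suc d)) (ih d (ℕ.≤∧≢⇒< k≤d k≢d))) (ℚ.*-zeroˡ (Q ^ suc k - Q ^ suc d))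
    where
    ih : ∀ d → k ℕ.< d → L d (Q ^ suc k) ≡ 0ℚ
    ih (suc d) (ℕ.s≤s k≤d) = L-vanish (suc d) -[1+ k ] (ℤ.-≤- k≤d) lt

  w : ℕ → ℕ → ℚ
  w zero zero = 1ℚ
  w zero (suc k) = 0ℚ
  w (suc d) zero = - (Q ^ suc d * w d zero)
  w (suc d) (suc k) = w d k - Q ^ suc d * w d (suc k)

  Σ< : ℕ → (ℕ → ℚ) → ℚ
  Σ< zero f = 0ℚ
  Σ< (suc n) f = f 0 + Σ< n (λ k → f (suc k))

  Σ<-cong : ∀ n {f g : ℕ → ℚ} → (∀ k → k ℕ.< n → f k ≡ g k) → Σ< n f ≡ Σ< n g
  Σ<-cong zero eq = refl
  Σ<-cong (suc n) eq = cong₂ _+_ (eq 0 ℕ.z<s) (Σ<-cong n (λ k lt → eq (suc k) (ℕ.s<s lt)))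

  Σ<-lincomb : ∀ n c d (f g : ℕ → ℚ) → Σ< n (λ k → c * f k + d * g k) ≡ c * Σ< n f + d * Σ< n g
  Σ<-lincomb zero c d f g = solve 2 (λ c d → con 0ℚ := c :* con 0ℚ :+ d :* con 0ℚ) refl c d
  Σ<-lincomb (suc n) c d f g = trans (cong (c * f 0 + d * g 0 +_) (Σ<-lincomb n c d (λ k → f (suc k)) (λ k → g (suc k))))
    (solve 6 (λ c d x y s t → c :* x :+ d :* y :+ (c :* s :+ d :* t) := c :* (x :+ s) :+ d :* (y :+ t)) refl
      c d (f 0) (g 0) (Σ< n (λ k → f (suc k))) (Σ< n (λ k → g (suc k))))

  Σ<-zero : ∀ n {f : ℕ → ℚ} → (∀ k → k ℕ.< n → f k ≡ 0ℚ) → Σ< n f ≡ 0ℚ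
  Σ<-zero zero eq = refl
  Σ<-zero (suc n) eq = trans (cong₂ _+_ (eq 0 ℕ.z<s) (Σ<-zero n (λ k lt → eq (suc k) (ℕ.s<s lt)))) refl

  Σ<-single : ∀ n (f : ℕ → ℚ) j → j ℕ.< n → (∀ k → k ℕ.< n → k ≢ j → f k ≡ 0ℚ) → Σ< n f ≡ f j
  Σ<-single (suc n) f zero _ eq = trans (cong (f 0 +_) (Σ<-zero n (λ k lt → eq (suc k) (ℕ.s<s lt) (λ ())))) (ℚ.+-identityʳ _)
  Σ<-single (suc n) f (suc j) (ℕ.s≤s lt) eq = trans (cong₂ _+_ (eq 0 ℕ.z<s (λ ()))
    (Σ<-single n (λ k → f (suc k)) j lt (λ k k<n k≢j → eq (suc k) (ℕ.s<s k<n) (λ e → k≢j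
        (ℕ.suc-injective e))))) (ℚ.+-identityˡ _)

  w-expand : ∀ d y N → d ℕ.< N → Σ< N (λ k → w d k * y ^ k) ≡ L d y
  w-expand zero y (suc N) _ = trans (cong (1ℚ * 1ℚ +_) (Σ<-zero N (λ k _ → ℚ.*-zeroˡ (y ^ suc k)))) refl
  w-expand (suc d) y (suc N) (ℕ.s≤s lt) = begin
    - (c * w d 0) * 1ℚ + Σ< N (λ k → (w d k - c * w d (suc k)) * (y * y ^ k))
      ≡⟨ cong (- (c * w d 0) * 1ℚ +_) (Σ<-cong N (λ k _ →
           solve 5 (λ a b c y z → (a :- c :* b) :* (y :* z) := y :* (a :* z) :+ :- c :* (b :* (y :* z))) refl
             (w d k) (w d (suc k)) c y (y ^ k))) ⟩
    - (c * w d 0) * 1ℚ + Σ< N (λ k → y * (w d k * y ^ k) + (- c) * (w d (suc k) * y ^ suc k))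
      ≡⟨ cong (- (c * w d 0) * 1ℚ +_) (Σ<-lincomb N y (- c) (λ k → w d k * y ^ k) (λ k → w d (suc k) * y ^ suc k)) ⟩
    - (c * w d 0) * 1ℚ + (y * A + (- c) * B)
      ≡⟨ solve 5 (λ c w y a b → :- (c :* w) :* con 1ℚ :+ (y :* a :+ :- c :* b) := y :* a :- c :*
          (w :* con 1ℚ :+ b)) refl c (w d 0) y A B ⟩
    y * A - c * (w d 0 * 1ℚ + B)
      ≡⟨ cong₂ (λ s t → y * s - c * t) (w-expand d y N lt) (w-expand d y (suc N) (ℕ.<-trans lt (ℕ.n<1+n N))) ⟩
    y * L d y - c * L d y
      ≡⟨ solve 3 (λ y l c → y :* l :- c :* l := l :* (y :- c)) refl y (L d y) c ⟩
    L d y * (y - c) ∎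
    where
    c = Q ^ suc d
    A = Σ< N (λ k → w d k * y ^ k)
    B = Σ< N (λ k → w d (suc k) * y ^ suc k)

  w-above : ∀ d k → d ℕ.< k → w d k ≡ 0ℚ
  w-above zero (suc k) _ = refl
  w-above (suc d) (suc k) (ℕ.s≤s lt) = trans (cong₂ (λ s t → s - Q ^ suc d * t) (w-above d k lt) (w-above d
      (suc k) (ℕ.<-trans lt (ℕ.n<1+n k))))
    (solve 1 (λ c → con 0ℚ :- c :* con 0ℚ := con 0ℚ) refl (Q ^ suc d))

  -- The q-factorial in base `Q`: (1 - Q)(1 - Q^2)...(1 - Q^k).
  G : ℕ → ℚ
  G k = L k 1ℚ

  -- In closed form (-1)^u Q^(u(u+1)/2).
  sgn : ℕ → ℚ
  sgn zero = 1ℚ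
  sgn (suc u) = sgn u * - (Q ^ suc u)

  -- The q-binomial theorem in base `Q` with denominators cleared: `w d k` is, up to `sgn`, the
  -- Gaussian binomial coefficient. The recursion of `w` becomes the q-Pascal rule.
  w-formula : ∀ k u → w (k ℕ.+ u) k * (G k * G u) ≡ sgn u * G (k ℕ.+ u)
  w-formula zero zero = refl
  w-formula zero (suc u) = begin
    - (Q ^ suc u * w u 0) * (1ℚ * (G u * (1ℚ - Q ^ suc u)))
      ≡⟨ solve 3 (λ c w g → :- (c :* w) :* (con 1ℚ :* (g :* (con 1ℚ :- c))) := w :* (con 1ℚ :* g) :* (:- c) :*
          (con 1ℚ :- c)) refl (Q ^ suc u) (w u 0) (G u) ⟩
    w u 0 * (1ℚ * G u) * - (Q ^ suc u) * (1ℚ - Q ^ suc u)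
      ≡⟨ cong (λ t → t * - (Q ^ suc u) * (1ℚ - Q ^ suc u)) (w-formula zero u) ⟩
    sgn u * G u * - (Q ^ suc u) * (1ℚ - Q ^ suc u)
      ≡⟨ solve 4 (λ s g c e → s :* g :* c :* e := s :* c :* (g :* e)) refl (sgn u) (G u) (- (Q ^ suc u)) (1ℚ - Q ^ suc u) ⟩
    sgn u * - (Q ^ suc u) * (G u * (1ℚ - Q ^ suc u)) ∎
  w-formula (suc k) zero = begin
    (w (k ℕ.+ 0) k - Q ^ suc (k ℕ.+ 0) * w (k ℕ.+ 0) (suc k)) * (G (suc k) * 1ℚ)
      ≡⟨ cong (λ t → (w (k ℕ.+ 0) k - Q ^ suc (k ℕ.+ 0) * t) * (G (suc k) * 1ℚ)) (w-above (k ℕ.+ 0) (suc k)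
          (ℕ.s≤s (ℕ.≤-reflexive (ℕ.+-identityʳ k)))) ⟩
    (w (k ℕ.+ 0) k - Q ^ suc (k ℕ.+ 0) * 0ℚ) * (G k * (1ℚ - Q ^ suc k) * 1ℚ)
      ≡⟨ solve 4 (λ w c g d → (w :- c :* con 0ℚ) :* (g :* d :* con 1ℚ) := w :* (g :* con 1ℚ) :* d) refl (w
          (k ℕ.+ 0) k) (Q ^ suc (k ℕ.+ 0)) (G k) (1ℚ - Q ^ suc k) ⟩
    w (k ℕ.+ 0) k * (G k * 1ℚ) * (1ℚ - Q ^ suc k)
      ≡⟨ cong₂ (λ s t → s * (1ℚ - Q ^ suc t)) (w-formula k zero) (sym (ℕ.+-identityʳ k)) ⟩
    1ℚ * G (k ℕ.+ 0) * (1ℚ - Q ^ suc (k ℕ.+ 0))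
      ≡⟨ ℚ.*-assoc 1ℚ (G (k ℕ.+ 0)) _ ⟩
    1ℚ * G (suc (k ℕ.+ 0)) ∎
  w-formula (suc k) (suc u) = begin
    (w (k ℕ.+ suc u) k - Q ^ suc (k ℕ.+ suc u) * w (k ℕ.+ suc u) (suc k)) * (G k * x * (G u * y))
      ≡⟨ cong (λ t → (w (k ℕ.+ suc u) k - Q ^ suc (k ℕ.+ suc u) * w t (suc k)) * (G k * x * (G u * y))) (ℕ.+-suc k u) ⟩
    (w (k ℕ.+ suc u) k - Q ^ suc (k ℕ.+ suc u) * w (suc k ℕ.+ u) (suc k)) * (G k * x * (G u * y))
      ≡⟨ solve 7 (λ a b c g x h y → (a :- c :* b) :* (g :* x :* (h :* y)) := a :* (g :* (h :* y)) :* x :- c :*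
          (b :* (g :* x :* h)) :* y) refl
          (w (k ℕ.+ suc u) k) (w (suc k ℕ.+ u) (suc k)) (Q ^ suc (k ℕ.+ suc u)) (G k) x (G u) y ⟩
    w (k ℕ.+ suc u) k * (G k * G (suc u)) * x - Q ^ suc (k ℕ.+ suc u) * (w (suc k ℕ.+ u) (suc k) * (G (suc k) * G u)) * y
      ≡⟨ cong₂ (λ s t → s * x - Q ^ suc (k ℕ.+ suc u) * t * y) (w-formula k (suc u)) (w-formula (suc k) u) ⟩
    sgn (suc u) * G (k ℕ.+ suc u) * x - Q ^ suc (k ℕ.+ suc u) * (sgn u * G (suc k ℕ.+ u)) * y
      ≡⟨ cong₂ (λ s t → sgn (suc u) * G (k ℕ.+ suc u) * x - s * (sgn u * G t) * y) (^-+ Q (suc k) (suc u))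
          (sym (ℕ.+-suc k u)) ⟩
    sgn u * - B * g * (1ℚ - A) - A * B * (sgn u * g) * (1ℚ - B)
      -- The q-Pascal rule in the form (1 - A) + A (1 - B) = 1 - A B.
      ≡⟨ solve 4 (λ s a b g → s :* :- b :* g :* (con 1ℚ :- a) :- a :* b :* (s :* g) :*
          (con 1ℚ :- b) := s :* :- b :* (g :* (con 1ℚ :- a :* b))) refl (sgn u) A B g ⟩
    sgn u * - B * (g * (1ℚ - A * B))
      ≡⟨ cong (λ t → sgn u * - B * (g * (1ℚ - t))) (sym (^-+ Q (suc k) (suc u))) ⟩
    sgn (suc u) * G (suc k ℕ.+ suc u) ∎
    where
    A = Q ^ suc k
    B = Q ^ suc u
    x = 1ℚ - A
    y = 1ℚ - B
    g = G (k ℕ.+ suc u)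

  -- Linear functionals on Laurent polynomials

  module _ {n : ℕ} (g : (Fin n → ℤ) → ℚ) where

    value : Term n → ℚ
    value (term c e v) = ι c * q ^ e * g v

    Lin : Poly n → ℚ
    Lin [] = 0ℚ
    Lin (t ∷ P) = value t + Lin P

    Lin-++ : ∀ P P′ → Lin (P ++ P′) ≡ Lin P + Lin P′
    Lin-++ [] P′ = sym (ℚ.+-identityˡ _)
    Lin-++ (t ∷ P) P′ = trans (cong (value t +_) (Lin-++ P P′)) (sym (ℚ.+-assoc (value t) (Lin P) (Lin P′)))

    -- Exactly what makes `Lin g` multiplicative. Evaluations at points arise from characters; the
    -- functional that extracts constant terms does not and is treated by linearity alone.
    record Character : Set where
      field
        unit : g zeroVec ≡ 1ℚ
        mult : ∀ u v → g (addVec u v) ≡ g u * g v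

    module _ (char : Character) where
      open Character char

      value-mul : ∀ s t → value (termMul s t) ≡ value s * value t
      value-mul (term c e u) (term d f v) = trans (cong₂ _*_ (cong₂ _*_ (ι-* c d) (^-+ q e f)) (mult u v))
        (solve 6 (λ a b x y z w → a :* b :* (x :* y) :* (z :* w) := a :* x :* z :* (b :* y :* w)) refl (ι c)
            (ι d) (q ^ e) (q ^ f) (g u) (g v))

      Lin-termMul : ∀ s P → Lin (map (termMul s) P) ≡ value s * Lin P
      Lin-termMul s [] = sym (ℚ.*-zeroʳ (value s))
      Lin-termMul s (t ∷ P) = trans (cong₂ _+_ (value-mul s t) (Lin-termMul s P)) (sym (ℚ.*-distribˡ-+
          (value s) (value t) (Lin P)))

      Lin-*P : ∀ P P′ → Lin (P *P P′) ≡ Lin P * Lin P′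
      Lin-*P [] P′ = sym (ℚ.*-zeroˡ (Lin P′))
      Lin-*P (t ∷ P) P′ = trans (Lin-++ (map (termMul t) P′) (P *P P′))
        (trans (cong₂ _+_ (Lin-termMul t P′) (Lin-*P P P′)) (sym (ℚ.*-distribʳ-+ (Lin P′) (value t) (Lin P))))

      Lin-1P : Lin 1P ≡ 1ℚ
      Lin-1P = trans (ℚ.+-identityʳ _) (trans (cong (1ℚ * 1ℚ *_) unit) refl)

      Lin-1-mono : ∀ e v → Lin (1P -P mono e v) ≡ 1ℚ - q ^ e * g v
      Lin-1-mono e v = trans (cong (λ t → ι 1ℤ * 1ℚ * t + (- 1ℚ * q ^ e * g v + 0ℚ)) unit)
        (solve 2 (λ x y → con 1ℚ :* con 1ℚ :* con 1ℚ :+ (con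
            (- 1ℚ) :* x :* y :+ con 0ℚ) := con 1ℚ :- x :* y) refl (q ^ e) (g v))

  prodL : {A : Set} → (A → ℚ) → List A → ℚ
  prodL f = foldr (λ x acc → f x * acc) 1ℚ

  Lin-prodP : ∀ {n} (g : (Fin n → ℤ) → ℚ) → Character g → {A : Set} (f : A → Poly n) → ∀ l →
    Lin g (prodP f l) ≡ prodL (Lin g ∘ f) l
  Lin-prodP g char f [] = Lin-1P g char
  Lin-prodP g char f (x ∷ l) = trans (Lin-*P g char (f x) (prodP f l)) (cong (Lin g (f x) *_) (Lin-prodP g char f l))

  pochℚ : ℚ → ℕ → ℚ
  pochℚ z zero = 1ℚ
  pochℚ z (suc k) = (1ℚ - z) * pochℚ (q * z) k

  Lin-poch : ∀ {n} (g : (Fin n → ℤ) → ℚ) → Character g → ∀ e v k → Lin g (poch e v k) ≡ pochℚ (q ^ e * g v) k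
  Lin-poch g char e v k = trans (Lin-prodP g char (λ l → 1P -P mono (e ℕ.+ l) v) (upTo k))
    (trans (go id 0 (λ _ → refl) k) (cong (λ m → pochℚ (q ^ m * g v) k) (ℕ.+-identityʳ e)))
    where
    -- `upTo` unfolds by composing its function with `suc`; hence the induction over all `h` that
    -- add a fixed offset.
    go : ∀ (h : ℕ → ℕ) m → (∀ l → h l ≡ m ℕ.+ l) → ∀ k →
      prodL (λ l → Lin g (1P -P mono (e ℕ.+ l) v)) (applyUpTo h k) ≡ pochℚ (q ^ (e ℕ.+ m) * g v) k
    go h m eq zero = refl
    go h m eq (suc k) = cong₂ _*_
      (trans (Lin-1-mono g char (e ℕ.+ h 0) v) (cong (λ t → 1ℚ - q ^ (e ℕ.+ t) * g v) (trans (eq 0) (ℕ.+-identityʳ m))))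
      (trans (go (h ∘ suc) (suc m) (λ l → trans (eq (suc l)) (ℕ.+-suc m l)) k)
        (cong (λ t → pochℚ t k) (trans (cong (λ t → q ^ t * g v) (ℕ.+-suc e m)) (ℚ.*-assoc q (q ^ (e ℕ.+ m)) (g v)))))

  pochℚ-vanish : ∀ z k l → l ℕ.< k → q ^ l * z ≡ 1ℚ → pochℚ z k ≡ 0ℚ
  pochℚ-vanish z (suc k) zero _ eq = trans (cong (λ t → (1ℚ - t) * pochℚ (q * z) k) (trans (sym
      (ℚ.*-identityˡ z)) eq)) (ℚ.*-zeroˡ (pochℚ (q * z) k))
  pochℚ-vanish z (suc k) (suc l) (ℕ.s≤s lt) eq = trans (cong ((1ℚ - z) *_) (pochℚ-vanish (q * z) k l lt
    (trans (solve 3 (λ q x z → x :* (q :* z) := q :* x :* z) refl q (q ^ l) z) eq))) (ℚ.*-zeroʳ (1ℚ - z))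

  prodL-zero : ∀ {A : Set} (f : A → ℚ) {x l} → x ∈ l → f x ≡ 0ℚ → prodL f l ≡ 0ℚ
  prodL-zero f {l = y ∷ l} (here refl) eq = trans (cong (_* prodL f l) eq) (ℚ.*-zeroˡ (prodL f l))
  prodL-zero f {l = y ∷ l} (there x∈) eq = trans (cong (f y *_) (prodL-zero f x∈ eq)) (ℚ.*-zeroʳ (f y))

  ∏ : ∀ n → (Fin n → ℚ) → ℚ
  ∏ zero f = 1ℚ
  ∏ (suc n) f = f Fin.zero * ∏ n (f ∘ Fin.suc)

  ∏-cong : ∀ n {f g : Fin n → ℚ} → (∀ i → f i ≡ g i) → ∏ n f ≡ ∏ n g
  ∏-cong zero eq = refl
  ∏-cong (suc n) eq = cong₂ _*_ (eq Fin.zero) (∏-cong n (eq ∘ Fin.suc))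

  ∏-* : ∀ n (f g : Fin n → ℚ) → ∏ n (λ i → f i * g i) ≡ ∏ n f * ∏ n g
  ∏-* zero f g = refl
  ∏-* (suc n) f g = trans (cong (f Fin.zero * g Fin.zero *_) (∏-* n (f ∘ Fin.suc) (g ∘ Fin.suc)))
    (solve 4 (λ a b c d → a :* b :* (c :* d) := a :* c :* (b :* d)) refl (f Fin.zero) (g Fin.zero) (∏ n
        (f ∘ Fin.suc)) (∏ n (g ∘ Fin.suc)))

  ∏-zero : ∀ n (f : Fin n → ℚ) i → f i ≡ 0ℚ → ∏ n f ≡ 0ℚ
  ∏-zero (suc n) f Fin.zero eq = trans (cong (_* ∏ n (f ∘ Fin.suc)) eq) (ℚ.*-zeroˡ (∏ n (f ∘ Fin.suc)))
  ∏-zero (suc n) f (Fin.suc i) eq = trans (cong (f Fin.zero *_) (∏-zero n (f ∘ Fin.suc) i eq)) (ℚ.*-zeroʳ (f Fin.zero))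

  ∏-pw : ∀ {n} (v : Fin n → ℤ) → ∏ n (λ i → pw (v i)) ≡ pw (sumℤ v)
  ∏-pw {zero} v = refl
  ∏-pw {suc n} v = trans (cong (pw (v Fin.zero) *_) (∏-pw (v ∘ Fin.suc))) (sym (pw-+ (v Fin.zero) (sumℤ (v ∘ Fin.suc))))

  prodL-tabulate : ∀ {A : Set} (f : A → ℚ) n (h : Fin n → A) → prodL f (tabulate h) ≡ ∏ n (f ∘ h)
  prodL-tabulate f zero h = refl
  prodL-tabulate f (suc n) h = cong (f (h Fin.zero) *_) (prodL-tabulate f n (h ∘ Fin.suc))

  pw-^ : ∀ k v → pw (pos k ℤ.* v) ≡ pw v ^ k
  pw-^ zero v = refl
  pw-^ (suc k) v = trans (cong pw (ℤ.suc-* (pos k) v)) (trans (pw-+ v (pos k ℤ.* v)) (cong (pw v *_) (pw-^ k v)))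

  -- Grid points are vectors, since singling one out by `α ≢ α₀` requires that points with equal
  -- coordinates be propositionally equal.
  sumBox : ∀ {n} → (Fin n → ℕ) → (Vec ℕ n → ℚ) → ℚ
  sumBox {zero} d f = f []
  sumBox {suc n} d f = Σ< (suc (d Fin.zero)) (λ k → sumBox (d ∘ Fin.suc) (λ α → f (k ∷ α)))

  sumBox-cong : ∀ {n} (d : Fin n → ℕ) {f g : Vec ℕ n → ℚ} → (∀ α → f α ≡ g α) → sumBox d f ≡ sumBox d g
  sumBox-cong {zero} d eq = eq []
  sumBox-cong {suc n} d eq = Σ<-cong (suc (d Fin.zero)) (λ k _ → sumBox-cong (d ∘ Fin.suc) (λ α → eq (k ∷ α)))

  sumBox-lincomb : ∀ {n} (d : Fin n → ℕ) a b (f g : Vec ℕ n → ℚ) →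
    sumBox d (λ α → a * f α + b * g α) ≡ a * sumBox d f + b * sumBox d g
  sumBox-lincomb {zero} d a b f g = refl
  sumBox-lincomb {suc n} d a b f g = trans
    (Σ<-cong (suc (d Fin.zero)) (λ k _ → sumBox-lincomb (d ∘ Fin.suc) a b (λ α → f (k ∷ α)) (λ α → g (k ∷ α))))
    (Σ<-lincomb (suc (d Fin.zero)) a b (λ k → sumBox (d ∘ Fin.suc) (λ α → f (k ∷ α))) (λ k → sumBox
        (d ∘ Fin.suc) (λ α → g (k ∷ α))))

  sumBox-zero : ∀ {n} (d : Fin n → ℕ) (f : Vec ℕ n → ℚ) → (∀ α → (∀ i → lookup α i ℕ.≤ d i) → f α ≡ 0ℚ) → sumBox d f ≡ 0ℚ
  sumBox-zero {zero} d f eq = eq [] (λ ())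
  sumBox-zero {suc n} d f eq = Σ<-zero (suc (d Fin.zero)) (λ k k≤ → sumBox-zero (d ∘ Fin.suc) (λ α → f (k ∷ α))
    (λ α le → eq (k ∷ α) (λ { Fin.zero → ℕ.s≤s⁻¹ k≤ ; (Fin.suc i) → le i })))

  sumBox-single : ∀ {n} (d : Fin n → ℕ) (f : Vec ℕ n → ℚ) α₀ → (∀ i → lookup α₀ i ℕ.≤ d i) →
    (∀ α → (∀ i → lookup α i ℕ.≤ d i) → α ≢ α₀ → f α ≡ 0ℚ) → sumBox d f ≡ f α₀
  sumBox-single {zero} d f [] le eq = refl
  sumBox-single {suc n} d f (k₀ ∷ α₀) le eq = trans
    (Σ<-single (suc (d Fin.zero)) (λ k → sumBox (d ∘ Fin.suc) (λ α → f (k ∷ α))) k₀ (ℕ.s≤s (le Fin.zero))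
      (λ k k≤ k≢ → sumBox-zero (d ∘ Fin.suc) (λ α → f (k ∷ α))
        (λ α α≤ → eq (k ∷ α) (λ { Fin.zero → ℕ.s≤s⁻¹ k≤ ; (Fin.suc i) → α≤ i }) (λ { refl → k≢ refl }))))
    (sumBox-single (d ∘ Fin.suc) (λ α → f (k₀ ∷ α)) α₀ (le ∘ Fin.suc)
      (λ α α≤ α≢ → eq (k₀ ∷ α) (λ { Fin.zero → le Fin.zero ; (Fin.suc i) → α≤ i }) (λ { refl → α≢ refl })))

  ∏-Σ< : ∀ {n} (d : Fin n → ℕ) (f : Fin n → ℕ → ℚ) →
    ∏ n (λ i → Σ< (suc (d i)) (f i)) ≡ sumBox d (λ α → ∏ n (λ i → f i (lookup α i)))
  ∏-Σ< {zero} d f = refl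
  ∏-Σ< {suc n} d f = begin
    Σ< (suc (d Fin.zero)) (f Fin.zero) * rest
      -- A zero multiple is added to make scaling an instance of `Σ<-lincomb`.
      ≡⟨ solve 2 (λ s r → s :* r := r :* s :+ con 0ℚ :* s) refl (Σ< (suc (d Fin.zero)) (f Fin.zero)) rest ⟩
    rest * Σ< (suc (d Fin.zero)) (f Fin.zero) + 0ℚ * Σ< (suc (d Fin.zero)) (f Fin.zero)
      ≡⟨ Σ<-lincomb (suc (d Fin.zero)) rest 0ℚ (f Fin.zero) (f Fin.zero) ⟨
    Σ< (suc (d Fin.zero)) (λ k → rest * f Fin.zero k + 0ℚ * f Fin.zero k)
      ≡⟨ Σ<-cong (suc (d Fin.zero)) (λ k _ → begin
          rest * f Fin.zero k + 0ℚ * f Fin.zero k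
            ≡⟨ solve 2 (λ x r → r :* x :+ con 0ℚ :* x := x :* r :+ con 0ℚ :* r) refl (f Fin.zero k) rest ⟩
          f Fin.zero k * rest + 0ℚ * rest
            ≡⟨ cong (λ t → f Fin.zero k * t + 0ℚ * t) (∏-Σ< (d ∘ Fin.suc) (f ∘ Fin.suc)) ⟩
          f Fin.zero k * sumBox (d ∘ Fin.suc) h + 0ℚ * sumBox (d ∘ Fin.suc) h
            ≡⟨ sumBox-lincomb (d ∘ Fin.suc) (f Fin.zero k) 0ℚ h h ⟨
          sumBox (d ∘ Fin.suc) (λ α → f Fin.zero k * h α + 0ℚ * h α)
            ≡⟨ sumBox-cong (d ∘ Fin.suc) (λ α → solve 2 (λ x y → x :* y :+ con 0ℚ :* y := x :* y) refl
                (f Fin.zero k) (h α)) ⟩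
          sumBox (d ∘ Fin.suc) (λ α → f Fin.zero k * h α) ∎) ⟩
    Σ< (suc (d Fin.zero)) (λ k → sumBox (d ∘ Fin.suc) (λ α → f Fin.zero k * h α)) ∎
    where
    rest = ∏ n (λ i → Σ< (suc (d (Fin.suc i))) (f (Fin.suc i)))
    h : Vec ℕ n → ℚ
    h α = ∏ n (λ i → f (Fin.suc i) (lookup α i))

  Lin-cong : ∀ {n} {g h : (Fin n → ℤ) → ℚ} → (∀ v → g v ≡ h v) → ∀ P → Lin g P ≡ Lin h P
  Lin-cong eq [] = refl
  Lin-cong eq (term c e v ∷ P) = cong₂ _+_ (cong (ι c * q ^ e *_) (eq v)) (Lin-cong eq P)

  Lin-sumBox : ∀ {n} (d : Fin n → ℕ) (u : Vec ℕ n → ℚ) (h : Vec ℕ n → (Fin n → ℤ) → ℚ) P →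
    Lin (λ v → sumBox d (λ α → u α * h α v)) P ≡ sumBox d (λ α → u α * Lin (h α) P)
  Lin-sumBox d u h [] = sym (trans (sumBox-cong d (λ α → ℚ.*-zeroʳ (u α))) (sumBox-zero d (λ _ → 0ℚ) (λ _ _ → refl)))
  Lin-sumBox d u h (term c e v ∷ P) = begin
    x * sumBox d (λ α → u α * h α v) + Lin (λ v → sumBox d (λ α → u α * h α v)) P
      ≡⟨ cong (x * sumBox d (λ α → u α * h α v) +_) (trans (Lin-sumBox d u h P) (sym (ℚ.*-identityˡ _))) ⟩
    x * sumBox d (λ α → u α * h α v) + 1ℚ * sumBox d (λ α → u α * Lin (h α) P)
      ≡⟨ sumBox-lincomb d x 1ℚ (λ α → u α * h α v) (λ α → u α * Lin (h α) P) ⟨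
    sumBox d (λ α → x * (u α * h α v) + 1ℚ * (u α * Lin (h α) P))
      ≡⟨ sumBox-cong d (λ α → solve 4 (λ x u y z → x :* (u :* y) :+ con 1ℚ :* (u :* z) := u :*
          (x :* y :+ z)) refl x (u α) (h α v) (Lin (h α) P)) ⟩
    sumBox d (λ α → u α * Lin (h α) (term c e v ∷ P)) ∎
    where x = ι c * q ^ e

  -- Constant terms as weighted sums of evaluations at x_i = q^(β_i)

  ev : ∀ {n} → (Fin n → ℤ) → Poly n → ℚ
  ev β = Lin (λ v → pw (dot β v))

  ev-char : ∀ {n} (β : Fin n → ℤ) → Character (λ v → pw (dot β v))
  ev-char β = record
    { unit = cong pw (dot-0 β)
    ; mult = λ u v → trans (cong pw (dot-+ β u v)) (pw-+ (dot β u) (dot β v)) }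

  constant : Poly 0 → ℚ
  constant = Lin (λ _ → 1ℚ)

  constant-char : Character {0} (λ _ → 1ℚ)
  constant-char = record { unit = refl ; mult = λ _ _ → refl }

  module _ {n : ℕ} (s : Fin n → ℤ) (d : Fin n → ℕ) where

    -- The factor `pw (s i ℤ.* v i)` equals 1 at exponent 0, so it does not disturb the extraction
    -- of the constant term; its effect is to translate the evaluation grid by `s`.
    Λ : (Fin n → ℤ) → ℚ
    Λ v = ∏ n (λ i → pw (s i ℤ.* v i) * L (d i) (pw (v i)))

    point : Vec ℕ n → Fin n → ℤ
    point α i = s i ℤ.+ pos (lookup α i)

    Λ-zero : ∀ v → (∀ i → v i ≡ 0ℤ) → Λ v ≡ ∏ n (λ i → G (d i))
    Λ-zero v eq = ∏-cong n (λ i → trans (cong₂ (λ x y → pw x * L (d i) (pw y)) (trans (cong (s i ℤ.*_) (eq i))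
        (ℤ.*-zeroʳ (s i))) (eq i)) (ℚ.*-identityˡ _))

    -- Nonnegative exponents with sum 0 all vanish, so some exponent lies in the range from -d i to
    -- -1 that the roots of `L` cover.
    Λ-nonzero : ∀ c e v → Bounded d (term c e v) → allZero v ≡ false → Λ v ≡ 0ℚ
    Λ-nonzero c e v (sum0 , low) nz with Fin.any? (λ i → v i ℤ.<? 0ℤ)
    ... | yes (i , neg) = ∏-zero n _ i (trans (cong (pw (s i ℤ.* v i) *_) (L-vanish (d i) (v i) (low i) neg))
        (ℚ.*-zeroʳ (pw (s i ℤ.* v i))))
    ... | no none with () ← trans (sym nz) (allZero⇐ v (sumℤ-zero v (λ i → ℤ.≮⇒≥ (λ lt → none (i , lt))) sum0))

    Lin-Λ : ∀ P → All (Bounded d) P → Lin Λ P ≡ constant (CT P) * ∏ n (λ i → G (d i))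
    Lin-Λ [] [] = sym (ℚ.*-zeroˡ (∏ n (λ i → G (d i))))
    Lin-Λ (term c e v ∷ P) (bd ∷ bds) with allZero v in eq
    ... | true = trans (cong₂ (λ x y → ι c * q ^ e * x + y) (Λ-zero v (allZero⇒ v eq)) (Lin-Λ P bds))
        (solve 3 (λ x g y → x :* g :+ y :* g := (x :* con 1ℚ :+ y) :* g) refl (ι c * q ^ e) (∏ n (λ i → G
            (d i))) (constant (CT P)))
    ... | false = trans (cong₂ (λ x y → ι c * q ^ e * x + y) (Λ-nonzero c e v bd eq) (Lin-Λ P bds))
        (solve 2 (λ x y → x :* con 0ℚ :+ y := y) refl (ι c * q ^ e) (constant (CT P) * ∏ n (λ i → G (d i))))

    Λ-expand : ∀ v → Λ v ≡ sumBox d (λ α → ∏ n (λ i → w (d i) (lookup α i)) * pw (dot (point α) v))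
    Λ-expand v = begin
      Λ v
        ≡⟨ ∏-cong n (λ i → expand i) ⟩
      ∏ n (λ i → Σ< (suc (d i)) (λ k → w (d i) k * pw ((s i ℤ.+ pos k) ℤ.* v i)))
        ≡⟨ ∏-Σ< d (λ i k → w (d i) k * pw ((s i ℤ.+ pos k) ℤ.* v i)) ⟩
      sumBox d (λ α → ∏ n (λ i → w (d i) (lookup α i) * pw (point α i ℤ.* v i)))
        ≡⟨ sumBox-cong d (λ α → trans (∏-* n _ _) (cong (∏ n (λ i → w (d i) (lookup α i)) *_) (∏-pw
            (λ i → point α i ℤ.* v i)))) ⟩
      sumBox d (λ α → ∏ n (λ i → w (d i) (lookup α i)) * pw (dot (point α) v)) ∎
      where
      expand : ∀ i → pw (s i ℤ.* v i) * L (d i) (pw (v i)) ≡ Σ< (suc (d i)) (λ k → w (d i) k * pw ((s i ℤ.+ pos k) ℤ.* v i))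
      expand i = begin
        x * L (d i) y
          ≡⟨ cong (x *_) (sym (w-expand (d i) y (suc (d i)) (ℕ.n<1+n (d i)))) ⟩
        x * S
          ≡⟨ solve 2 (λ x s → x :* s := x :* s :+ con 0ℚ :* s) refl x S ⟩
        x * S + 0ℚ * S
          ≡⟨ Σ<-lincomb (suc (d i)) x 0ℚ (λ k → w (d i) k * y ^ k) (λ k → w (d i) k * y ^ k) ⟨
        Σ< (suc (d i)) (λ k → x * (w (d i) k * y ^ k) + 0ℚ * (w (d i) k * y ^ k))
          ≡⟨ Σ<-cong (suc (d i)) (λ k _ → trans (solve 3 (λ x w z → x :* (w :* z) :+ con 0ℚ :*
              (w :* z) := w :* (x :* z)) refl x (w (d i) k) (y ^ k))
               (cong (w (d i) k *_) (sym (trans (cong pw (ℤ.*-distribʳ-+ (v i) (s i) (pos k))) (trans (pw-+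
                   (s i ℤ.* v i) (pos k ℤ.* v i)) (cong (x *_) (pw-^ k (v i)))))))) ⟩
        Σ< (suc (d i)) (λ k → w (d i) k * pw ((s i ℤ.+ pos k) ℤ.* v i)) ∎
        where
        x = pw (s i ℤ.* v i)
        y = pw (v i)
        S = Σ< (suc (d i)) (λ k → w (d i) k * y ^ k)

    -- `Lin Λ P` computed twice: monomial by monomial, and after expanding each `L`, where the k-th
    -- power of `pw (v i)` moves the i-th coordinate of the evaluation point by k.
    interpolation : ∀ P → All (Bounded d) P →
      constant (CT P) * ∏ n (λ i → G (d i)) ≡ sumBox d (λ α → ∏ n (λ i → w (d i) (lookup α i)) * ev (point α) P)
    interpolation P bds = begin
      constant (CT P) * ∏ n (λ i → G (d i)) ≡⟨ Lin-Λ P bds ⟨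
      Lin Λ P ≡⟨ Lin-cong Λ-expand P ⟩
      Lin (λ v → sumBox d (λ α → ∏ n (λ i → w (d i) (lookup α i)) * pw (dot (point α) v))) P
        ≡⟨ Lin-sumBox d (λ α → ∏ n (λ i → w (d i) (lookup α i))) (λ α v → pw (dot (point α) v)) P ⟩
      sumBox d (λ α → ∏ n (λ i → w (d i) (lookup α i)) * ev (point α) P) ∎

  -- Products over unordered pairs and calculation up to units

  prodL-↭ : ∀ {A : Set} (f : A → ℚ) {l l′} → l ↭ l′ → prodL f l ≡ prodL f l′
  prodL-↭ f ↭.refl = refl
  prodL-↭ f (↭.prep x eq) = cong (f x *_) (prodL-↭ f eq)
  prodL-↭ f (↭.swap {xs} {ys} x y eq) = trans (cong (λ t → f x * (f y * t)) (prodL-↭ f eq))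
    (solve 3 (λ a b c → a :* (b :* c) := b :* (a :* c)) refl (f x) (f y) (prodL f ys))
  prodL-↭ f (↭.trans e₁ e₂) = trans (prodL-↭ f e₁) (prodL-↭ f e₂)

  prodL-* : ∀ {A : Set} (f g : A → ℚ) l → prodL (λ x → f x * g x) l ≡ prodL f l * prodL g l
  prodL-* f g [] = refl
  prodL-* f g (x ∷ l) = trans (cong (f x * g x *_) (prodL-* f g l))
    (solve 4 (λ a b c d → a :* b :* (c :* d) := a :* c :* (b :* d)) refl (f x) (g x) (prodL f l) (prodL g l))

  pairProd : ∀ {A : Set} → (A → A → ℚ) → List A → ℚ
  pairProd f [] = 1ℚ
  pairProd f (x ∷ xs) = prodL (f x) xs * pairProd f xs

  -- Swapping two neighbours reverses exactly one pair, which the symmetry of `f` absorbs.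
  pairProd-↭ : ∀ {A : Set} (f : A → A → ℚ) → (∀ x y → f x y ≡ f y x) → ∀ {l l′} → l ↭ l′ → pairProd f l ≡ pairProd f l′
  pairProd-↭ f f-sym ↭.refl = refl
  pairProd-↭ f f-sym (↭.prep x eq) = cong₂ _*_ (prodL-↭ (f x) eq) (pairProd-↭ f f-sym eq)
  pairProd-↭ f f-sym (↭.swap {xs} {ys} x y eq) = trans
    (cong₂ _*_ (cong₂ _*_ (f-sym x y) (prodL-↭ (f x) eq)) (cong₂ _*_ (prodL-↭ (f y) eq) (pairProd-↭ f f-sym eq)))
    (solve 4 (λ a b c d → a :* b :* (c :* d) := a :* c :* (b :* d)) refl (f y x) (prodL (f x) ys) (prodL
        (f y) ys) (pairProd f ys))
  pairProd-↭ f f-sym (↭.trans e₁ e₂) = trans (pairProd-↭ f f-sym e₁) (pairProd-↭ f f-sym e₂)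

  prodL-++ : ∀ {A : Set} (f : A → ℚ) l l′ → prodL f (l ++ l′) ≡ prodL f l * prodL f l′
  prodL-++ f [] l′ = sym (ℚ.*-identityˡ _)
  prodL-++ f (x ∷ l) l′ = trans (cong (f x *_) (prodL-++ f l l′)) (sym (ℚ.*-assoc (f x) (prodL f l) (prodL f l′)))

  prodL-map : ∀ {A B : Set} (f : B → ℚ) (g : A → B) l → prodL f (map g l) ≡ prodL (f ∘ g) l
  prodL-map f g [] = refl
  prodL-map f g (x ∷ l) = cong (f (g x) *_) (prodL-map f g l)

  prodL-cong : ∀ {A : Set} {f g : A → ℚ} {l} → All (λ x → f x ≡ g x) l → prodL f l ≡ prodL g l
  prodL-cong [] = refl
  prodL-cong (e ∷ es) = cong₂ _*_ e (prodL-cong es)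

  prodL-upairs : ∀ {A : Set} (f : A → A → ℚ) l → prodL (uncurry f) (upairs l) ≡ pairProd f l
  prodL-upairs f [] = refl
  prodL-upairs f (x ∷ xs) = trans (prodL-++ (uncurry f) (map (x ,_) xs) (upairs xs))
    (cong₂ _*_ (prodL-map (uncurry f) (x ,_) xs) (prodL-upairs f xs))

  pairProd-cong : ∀ {A : Set} {f g : A → A → ℚ} {l} → AllPairs (λ x y → f x y ≡ g x y) l → pairProd f l ≡ pairProd g l
  pairProd-cong [] = refl
  pairProd-cong (es ∷ ess) = cong₂ _*_ (prodL-cong es) (pairProd-cong ess)

  pairProd-zero : ∀ {A : Set} (f : A → A → ℚ) → (∀ x y → f x y ≡ f y x) → ∀ {x y} → f x y ≡ 0ℚ → x ≢ y →
    ∀ {l} → x ∈ l → y ∈ l → pairProd f l ≡ 0ℚ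
  pairProd-zero f f-sym z x≢y (here refl) (here refl) = contradiction refl x≢y
  pairProd-zero f f-sym {x} z x≢y {_ ∷ l} (here refl) (there y∈) = trans (cong (_* pairProd f l) (prodL-zero
      (f x) y∈ z)) (ℚ.*-zeroˡ (pairProd f l))
  pairProd-zero f f-sym {x} {y} z x≢y {_ ∷ l} (there x∈) (here refl) = trans (cong (_* pairProd f l)
      (prodL-zero (f y) x∈ (trans (f-sym y x) z))) (ℚ.*-zeroˡ (pairProd f l))
  pairProd-zero f f-sym z x≢y {u ∷ l} (there x∈) (there y∈) = trans (cong (prodL (f u) l *_)
      (pairProd-zero f f-sym z x≢y x∈ y∈)) (ℚ.*-zeroʳ (prodL (f u) l))

  -- Products are only tracked up to factors ± q^z; the factor is pinned down at the end by reduction modulo q.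
  Unit : ℚ → Set
  Unit u = ∃ λ z → u ≡ pw z ⊎ u ≡ - pw z

  Unit-* : ∀ {u v} → Unit u → Unit v → Unit (u * v)
  Unit-* (x , inj₁ refl) (y , inj₁ refl) = x ℤ.+ y , inj₁ (sym (pw-+ x y))
  Unit-* (x , inj₁ refl) (y , inj₂ refl) = x ℤ.+ y , inj₂ (trans (sym (ℚ.neg-distribʳ-* (pw x) (pw y)))
      (cong -_ (sym (pw-+ x y))))
  Unit-* (x , inj₂ refl) (y , inj₁ refl) = x ℤ.+ y , inj₂ (trans (sym (ℚ.neg-distribˡ-* (pw x) (pw y)))
      (cong -_ (sym (pw-+ x y))))
  Unit-* (x , inj₂ refl) (y , inj₂ refl) = x ℤ.+ y , inj₁ (trans (solve 2
      (λ a b → :- a :* :- b := a :* b) refl (pw x) (pw y)) (sym (pw-+ x y)))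

  infix 4 _~_

  _~_ : ℚ → ℚ → Set
  x ~ y = ∃ λ u → Unit u × x ≡ u * y

  ≡⇒~ : ∀ {x y} → x ≡ y → x ~ y
  ≡⇒~ {x} refl = 1ℚ , (0ℤ , inj₁ refl) , sym (ℚ.*-identityˡ x)

  ~-trans : ∀ {x y z} → x ~ y → y ~ z → x ~ z
  ~-trans {z = z} (u , U , refl) (v , V , refl) = u * v , Unit-* U V , sym (ℚ.*-assoc u v z)

  Unit-inverse : ∀ {u} → Unit u → ∃ λ v → Unit v × v * u ≡ 1ℚ
  Unit-inverse (z , inj₁ refl) = pw (ℤ.- z) , (ℤ.- z , inj₁ refl) , trans (sym (pw-+ (ℤ.- z) z)) (cong pw (ℤ.+-inverseˡ z))
  Unit-inverse (z , inj₂ refl) = - pw (ℤ.- z) , (ℤ.- z , inj₂ refl) ,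
    trans (solve 2 (λ a b → :- a :* :- b := a :* b) refl (pw (ℤ.- z)) (pw z)) (trans (sym (pw-+ (ℤ.- z) z))
        (cong pw (ℤ.+-inverseˡ z)))

  ~-sym : ∀ {x y} → x ~ y → y ~ x
  ~-sym {y = y} (u , U , refl) with Unit-inverse U
  ... | v , V , vu = v , V , sym (trans (sym (ℚ.*-assoc v u y)) (trans (cong (_* y) vu) (ℚ.*-identityˡ y)))

  ~-* : ∀ {x y x′ y′} → x ~ y → x′ ~ y′ → x * x′ ~ y * y′
  ~-* {y = y} {y′ = y′} (u , U , refl) (v , V , refl) = u * v , Unit-* U V ,
    solve 4 (λ u v y z → u :* y :* (v :* z) := u :* v :* (y :* z)) refl u v y y′

  ~-*ʳ : ∀ {x y} z → x ~ y → x * z ~ y * z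
  ~-*ʳ z e = ~-* e (≡⇒~ refl)

  ~-*ˡ : ∀ {x y} z → x ~ y → z * x ~ z * y
  ~-*ˡ z e = ~-* {z} (≡⇒~ refl) e

  ~-prodL : ∀ {A : Set} (f g : A → ℚ) l → All (λ x → f x ~ g x) l → prodL f l ~ prodL g l
  ~-prodL f g [] [] = ≡⇒~ refl
  ~-prodL f g (x ∷ l) (e ∷ es) = ~-* e (~-prodL f g l es)

  infixr 2 _~⟨_⟩_ _≡⇒~⟨_⟩_
  infix 3 _~∎

  _~⟨_⟩_ : ∀ x {y z} → x ~ y → y ~ z → x ~ z
  _ ~⟨ e ⟩ e′ = ~-trans e e′

  _≡⇒~⟨_⟩_ : ∀ x {y z} → x ≡ y → y ~ z → x ~ z
  _ ≡⇒~⟨ refl ⟩ e′ = e′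

  _~∎ : ∀ x → x ~ x
  _ ~∎ = ≡⇒~ refl

  q^Q^ : ∀ k → q ^ k * Q ^ k ≡ 1ℚ
  q^Q^ k = trans (sym (pw-⊖ k k)) (cong pw (ℤ.n⊖n≡0 k))

  -- The two differ by the factor -q^k. Up to units, everything can thus be written with the single
  -- family `G`.
  1-q~1-Q : ∀ k → 1ℚ - q ^ k ~ 1ℚ - Q ^ k
  1-q~1-Q k = - q ^ k , (pos k , inj₂ refl) , sym (begin
    - q ^ k * (1ℚ - Q ^ k) ≡⟨ solve 2 (λ x y → :- x :* (con 1ℚ :- y) := x :* y :- x) refl (q ^ k) (Q ^ k) ⟩
    q ^ k * Q ^ k - q ^ k ≡⟨ cong (_- q ^ k) (q^Q^ k) ⟩
    1ℚ - q ^ k ∎)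

  poch-up : ∀ y b → pochℚ (q ^ suc y) b * G y ~ G (y ℕ.+ b)
  poch-up y zero = ≡⇒~ (trans (ℚ.*-identityˡ (G y)) (cong G (sym (ℕ.+-identityʳ y))))
  poch-up y (suc b) =
    (1ℚ - q ^ suc y) * pochℚ (q ^ suc (suc y)) b * G y
      ≡⇒~⟨ solve 3 (λ x z g → x :* z :* g := z :* (g :* x)) refl (1ℚ - q ^ suc y) (pochℚ (q ^ suc (suc y)) b) (G y) ⟩
    pochℚ (q ^ suc (suc y)) b * (G y * (1ℚ - q ^ suc y))
      ~⟨ ~-*ˡ (pochℚ (q ^ suc (suc y)) b) (~-*ˡ (G y) (1-q~1-Q (suc y))) ⟩
    pochℚ (q ^ suc (suc y)) b * G (suc y)
      ~⟨ poch-up (suc y) b ⟩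
    G (suc y ℕ.+ b)
      ≡⇒~⟨ cong G (sym (ℕ.+-suc y b)) ⟩
    G (y ℕ.+ suc b) ~∎

  -- Multiplication by q lowers the power of `Q`, so the factors run from 1 - Q^(x+a) down to 1 -
  -- Q^(x+1): those that `G (x + a)` has beyond `G x`.
  poch-down : ∀ x a → pochℚ (Q ^ (x ℕ.+ a)) a * G x ≡ G (x ℕ.+ a)
  poch-down x zero = trans (ℚ.*-identityˡ (G x)) (cong G (sym (ℕ.+-identityʳ x)))
  poch-down x (suc a) = begin
    (1ℚ - Q ^ (x ℕ.+ suc a)) * pochℚ (q * Q ^ (x ℕ.+ suc a)) a * G x
      ≡⟨ cong (λ t → (1ℚ - Q ^ t) * pochℚ (q * Q ^ t) a * G x) (ℕ.+-suc x a) ⟩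
    (1ℚ - c) * pochℚ (q * (Q * Q ^ (x ℕ.+ a))) a * G x
      ≡⟨ cong (λ t → (1ℚ - c) * pochℚ t a * G x) (trans (sym (ℚ.*-assoc q Q _)) (trans (cong (_* Q ^
          (x ℕ.+ a)) qQ) (ℚ.*-identityˡ _))) ⟩
    (1ℚ - c) * pochℚ (Q ^ (x ℕ.+ a)) a * G x
      ≡⟨ trans (ℚ.*-assoc (1ℚ - c) _ (G x)) (trans (cong ((1ℚ - c) *_) (poch-down x a)) (ℚ.*-comm (1ℚ - c) _)) ⟩
    G (suc (x ℕ.+ a))
      ≡⟨ cong G (sym (ℕ.+-suc x a)) ⟩
    G (x ℕ.+ suc a) ∎
    where c = Q ^ suc (x ℕ.+ a)

  -- Telescoping at the surviving point

  module Telescope {n : ℕ} (a : Fin n → ℕ) (r : Fin n) (M : Fin n → Bool) (α : Fin n → ℕ) where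
    open Prefixes a

    data EndsIn : List (Fin n) → Set where
      end : EndsIn (r ∷ [])
      _∷_ : ∀ {x xs} → x ≢ r → EndsIn xs → EndsIn (x ∷ xs)

    data MFirst : List (Fin n) → Set where
      none : ∀ {l} → All (λ x → M x ≡ false) l → MFirst l
      _∷_  : ∀ {x xs} → M x ≡ true → MFirst xs → MFirst (x ∷ xs)

    before after : Fin n → Fin n → ℚ
    before i j = pochℚ (pw (pos (α i) ℤ.- pos (α j))) (a i)
    after j i = pochℚ (pw (1ℤ ℤ.+ (pos (α j) ℤ.- pos (α i)))) (a j ℕ.+ χ (M i ∧ (j ==F r)))

    -- `B` is the sum of `a` strictly between `x` and `y`. The descending factorial takes `G B` to
    -- `G (a x + B)`, and the ascending one continues from there by the exponent of (y, x).
    pair-value : ∀ x y A B → α x ≡ A → α y ≡ A ℕ.+ a x ℕ.+ B →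
      before x y * after y x * G B ~ G (a x ℕ.+ B ℕ.+ (a y ℕ.+ χ (M x ∧ (y ==F r))))
    pair-value x y A B αx αy =
      before x y * after y x * G B
        ≡⇒~⟨ cong₂ (λ s t → pochℚ s (a x) * pochℚ t e * G B)
              (cong pw (cong₂ (λ s t → pos s ℤ.- pos t) αx αy))
              (cong pw (cong₂ (λ s t → 1ℤ ℤ.+ (pos s ℤ.- pos t)) αy αx)) ⟩
      pochℚ (pw (pos A ℤ.- pos (A ℕ.+ a x ℕ.+ B))) (a x) * pochℚ (pw (1ℤ ℤ.+ (pos (A ℕ.+ a x ℕ.+ B) ℤ.- pos A))) e * G B
        ≡⇒~⟨ cong₂ (λ s t → pochℚ s (a x) * pochℚ t e * G B) low high ⟩
      pochℚ (Q ^ (B ℕ.+ a x)) (a x) * pochℚ (q ^ suc (a x ℕ.+ B)) e * G B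
        ≡⇒~⟨ solve 3 (λ s t g → s :* t :* g := t :* (s :* g)) refl (pochℚ (Q ^ (B ℕ.+ a x)) (a x)) (pochℚ
            (q ^ suc (a x ℕ.+ B)) e) (G B) ⟩
      pochℚ (q ^ suc (a x ℕ.+ B)) e * (pochℚ (Q ^ (B ℕ.+ a x)) (a x) * G B)
        ≡⇒~⟨ cong (pochℚ (q ^ suc (a x ℕ.+ B)) e *_) (trans (poch-down B (a x)) (cong G (ℕ.+-comm B (a x)))) ⟩
      pochℚ (q ^ suc (a x ℕ.+ B)) e * G (a x ℕ.+ B)
        ~⟨ poch-up (a x ℕ.+ B) e ⟩
      G (a x ℕ.+ B ℕ.+ e) ~∎
      where
      e = a y ℕ.+ χ (M x ∧ (y ==F r))
      difference : pos (A ℕ.+ a x ℕ.+ B) ℤ.- pos A ≡ pos (a x ℕ.+ B)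
      difference = begin
        pos (A ℕ.+ a x ℕ.+ B) ℤ.- pos A ≡⟨ cong (λ t → pos t ℤ.- pos A) (ℕ.+-assoc A (a x) B) ⟩
        pos (A ℕ.+ (a x ℕ.+ B)) ℤ.- pos A ≡⟨ cong (ℤ._- pos A) (ℤ.+-comm (pos A) (pos (a x ℕ.+ B))) ⟩
        (pos (a x ℕ.+ B) ℤ.+ pos A) ℤ.- pos A ≡⟨ ℤ.+-assoc (pos (a x ℕ.+ B)) (pos A) (ℤ.- pos A) ⟩
        pos (a x ℕ.+ B) ℤ.+ (pos A ℤ.- pos A) ≡⟨ cong (λ t → pos (a x ℕ.+ B) ℤ.+ t) (ℤ.+-inverseʳ (pos A)) ⟩
        pos (a x ℕ.+ B) ℤ.+ 0ℤ ≡⟨ ℤ.+-identityʳ _ ⟩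
        pos (a x ℕ.+ B) ∎
      low : pw (pos A ℤ.- pos (A ℕ.+ a x ℕ.+ B)) ≡ Q ^ (B ℕ.+ a x)
      low = trans (cong pw (trans (swap-minus (pos A) (pos (A ℕ.+ a x ℕ.+ B))) (cong ℤ.-_ difference)))
              (trans (pw-neg (a x ℕ.+ B)) (cong (Q ^_) (ℕ.+-comm (a x) B)))
      high : pw (1ℤ ℤ.+ (pos (A ℕ.+ a x ℕ.+ B) ℤ.- pos A)) ≡ q ^ suc (a x ℕ.+ B)
      high = cong (λ t → pw (1ℤ ℤ.+ t)) difference

    -- Products of G over the partial sums of a starting at B: H includes the current summand, Hexc excludes it.
    H Hexc : ℕ → List (Fin n) → ℚ
    H B [] = 1ℚ
    H B (y ∷ ys) = G (B ℕ.+ a y) * H (B ℕ.+ a y) ys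
    Hexc B [] = 1ℚ
    Hexc B (y ∷ ys) = G B * Hexc (B ℕ.+ a y) ys

    -- Both sides are the product of `G` over all partial sums, the first and the last included.
    Hexc-H : ∀ B l → Hexc B l * G (B ℕ.+ total l) ≡ G B * H B l
    Hexc-H B [] = trans (ℚ.*-identityˡ _) (trans (cong G (ℕ.+-identityʳ B)) (sym (ℚ.*-identityʳ _)))
    Hexc-H B (y ∷ ys) = begin
      G B * Hexc (B ℕ.+ a y) ys * G (B ℕ.+ (a y ℕ.+ total ys))
        ≡⟨ ℚ.*-assoc (G B) (Hexc (B ℕ.+ a y) ys) _ ⟩
      G B * (Hexc (B ℕ.+ a y) ys * G (B ℕ.+ (a y ℕ.+ total ys)))
        ≡⟨ cong (λ t → G B * (Hexc (B ℕ.+ a y) ys * G t)) (sym (ℕ.+-assoc B (a y) (total ys))) ⟩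
      G B * (Hexc (B ℕ.+ a y) ys * G (B ℕ.+ a y ℕ.+ total ys))
        ≡⟨ cong (G B *_) (Hexc-H (B ℕ.+ a y) ys) ⟩
      G B * (G (B ℕ.+ a y) * H (B ℕ.+ a y) ys) ∎

    Hexc-prefix : ∀ {A l} → Prefix α A l → Hexc A l ≡ prodL (G ∘ α) l
    Hexc-prefix [] = refl
    Hexc-prefix (_∷_ {x = x} refl es) = cong (G (α x) *_) (Hexc-prefix es)

    row : Fin n → Fin n → ℚ
    row x y = before x y * after y x

    row-step : ∀ x y ys A B e X → α x ≡ A → α y ≡ A ℕ.+ a x ℕ.+ B → a y ℕ.+ χ (M x ∧ (y ==F r)) ≡ e →
      prodL (row x) ys * Hexc (B ℕ.+ a y) ys ~ X →
      prodL (row x) (y ∷ ys) * Hexc B (y ∷ ys) ~ G (a x ℕ.+ B ℕ.+ e) * X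
    row-step x y ys A B e X αx αy refl ih =
      row x y * prodL (row x) ys * (G B * Hexc (B ℕ.+ a y) ys)
        ≡⇒~⟨ solve 4 (λ f p g h → f :* p :* (g :* h) := f :* g :* (p :* h)) refl (row x y) (prodL (row x) ys)
            (G B) (Hexc (B ℕ.+ a y) ys) ⟩
      row x y * G B * (prodL (row x) ys * Hexc (B ℕ.+ a y) ys)
        ~⟨ ~-* (pair-value x y A B αx αy) ih ⟩
      G (a x ℕ.+ B ℕ.+ e) * X ~∎

    prefix-shift : ∀ {A B x y ys} → Prefix α (A ℕ.+ a x ℕ.+ B ℕ.+ a y) ys → Prefix α (A ℕ.+ a x ℕ.+ (B ℕ.+ a y)) ys
    prefix-shift {A} {B} {x} {y} {ys} = subst (λ t → Prefix α t ys) (ℕ.+-assoc (A ℕ.+ a x) B (a y))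

    -- By `pair-value` each later `y` contributes a quotient of two values of `G`. The denominators
    -- make up `Hexc B xs`; the numerators are taken at the partial sums that include both `a x` and
    -- `a y`.
    row-plain : ∀ x xs A B → M x ≡ false → α x ≡ A → Prefix α (A ℕ.+ a x ℕ.+ B) xs →
      prodL (row x) xs * Hexc B xs ~ H (a x ℕ.+ B) xs
    row-plain x [] A B Mx αx _ = ≡⇒~ refl
    row-plain x (y ∷ ys) A B Mx αx (αy ∷ pre) = ~-trans
      (row-step x y ys A B (a y) _ αx αy (trans (cong (λ b → a y ℕ.+ χ (b ∧ (y ==F r))) Mx) (ℕ.+-identityʳ _))
        (row-plain x ys A (B ℕ.+ a y) Mx αx (prefix-shift {A} {B} {x} {y} pre)))
      (≡⇒~ (cong (λ t → G (a x ℕ.+ B ℕ.+ a y) * H t ys) (sym (ℕ.+-assoc (a x) B (a y)))))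

    -- As for a plain row, except that the last entry is `r`, whose exponent is raised by 1 against
    -- `x` in `M`. This lengthens the last `G` by one factor.
    row-star : ∀ x xs A B → M x ≡ true → EndsIn xs → α x ≡ A → Prefix α (A ℕ.+ a x ℕ.+ B) xs →
      prodL (row x) xs * Hexc B xs ~ H (a x ℕ.+ B) xs * (1ℚ - Q ^ suc (a x ℕ.+ B ℕ.+ total xs))
    row-star x (y ∷ []) A B Mx end αx (αy ∷ []) =
      prodL (row x) (y ∷ []) * Hexc B (y ∷ [])
        ~⟨ row-step x y [] A B (suc (a y)) 1ℚ αx αy
            (trans (cong₂ (λ b c → a y ℕ.+ χ (b ∧ c)) Mx (==F-refl y)) (ℕ.+-comm (a y) 1)) (≡⇒~ refl) ⟩
      G (a x ℕ.+ B ℕ.+ suc (a y)) * 1ℚ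
        ≡⇒~⟨ cong (λ t → G t * 1ℚ) (ℕ.+-suc (a x ℕ.+ B) (a y)) ⟩
      G (a x ℕ.+ B ℕ.+ a y) * (1ℚ - Q ^ suc (a x ℕ.+ B ℕ.+ a y)) * 1ℚ
        ≡⇒~⟨ solve 2 (λ g c → g :* c :* con 1ℚ := g :* con 1ℚ :* c) refl (G (a x ℕ.+ B ℕ.+ a y)) (1ℚ - Q ^ suc
            (a x ℕ.+ B ℕ.+ a y)) ⟩
      G (a x ℕ.+ B ℕ.+ a y) * 1ℚ * (1ℚ - Q ^ suc (a x ℕ.+ B ℕ.+ a y))
        ≡⇒~⟨ cong (λ t → G (a x ℕ.+ B ℕ.+ a y) * 1ℚ * (1ℚ - Q ^ suc (a x ℕ.+ B ℕ.+ t))) (sym (ℕ.+-identityʳ (a y))) ⟩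
      G (a x ℕ.+ B ℕ.+ a y) * 1ℚ * (1ℚ - Q ^ suc (a x ℕ.+ B ℕ.+ (a y ℕ.+ 0))) ~∎
    row-star x (y ∷ ys) A B Mx (y≢r ∷ ends) αx (αy ∷ pre) =
      prodL (row x) (y ∷ ys) * Hexc B (y ∷ ys)
        ~⟨ row-step x y ys A B (a y) _ αx αy (trans (cong₂ (λ b c → a y ℕ.+ χ (b ∧ c)) Mx (==F-≢ y≢r)) (ℕ.+-identityʳ _))
             (row-star x ys A (B ℕ.+ a y) Mx ends αx (prefix-shift {A} {B} {x} {y} pre)) ⟩
      G (a x ℕ.+ B ℕ.+ a y) * (H (a x ℕ.+ (B ℕ.+ a y)) ys * (1ℚ - Q ^ suc (a x ℕ.+ (B ℕ.+ a y) ℕ.+ total ys)))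
        ≡⇒~⟨ cong₂ (λ s t → G (a x ℕ.+ B ℕ.+ a y) * (H s ys * (1ℚ - Q ^ suc t))) (sym (ℕ.+-assoc (a x) B
            (a y))) (regroup (a x) B (a y) (total ys)) ⟩
      G (a x ℕ.+ B ℕ.+ a y) * (H (a x ℕ.+ B ℕ.+ a y) ys * c)
        ≡⇒~⟨ sym (ℚ.*-assoc (G (a x ℕ.+ B ℕ.+ a y)) (H (a x ℕ.+ B ℕ.+ a y) ys) c) ⟩
      H (a x ℕ.+ B) (y ∷ ys) * c ~∎
      where
      c = 1ℚ - Q ^ suc (a x ℕ.+ B ℕ.+ (a y ℕ.+ total ys))
      regroup : ∀ u v w t → u ℕ.+ (v ℕ.+ w) ℕ.+ t ≡ u ℕ.+ v ℕ.+ (w ℕ.+ t)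
      regroup = ℕ-Solver.solve-∀

    -- At the surviving point the argument of `G` is d_x - α_x, so this is the part of the
    -- interpolation weights that looks ahead in the order.
    Suf : List (Fin n) → ℚ
    Suf [] = 1ℚ
    Suf (x ∷ xs) = G (total xs ℕ.+ χ (M x)) * Suf xs

    outside : List (Fin n) → ℕ
    outside l = foldr ℕ._+_ 0 (map (λ v → if M v then 0 else a v) l)

    -- Row by row. `Hexc-H` at 0 trades `H 0 xs` for `Hexc 0 xs * G (total xs)`: the first cancels
    -- the denominators of the new row, the second is the new factor of `Suf`.
    pairs-plain : ∀ l A → All (λ x → M x ≡ false) l → Prefix α A l →
      pairProd row l * prodL (G ∘ a) l ~ H 0 l * Suf l
    pairs-plain [] A [] [] = ≡⇒~ refl
    pairs-plain (x ∷ xs) A (Mx ∷ Mxs) (αx ∷ pre) =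
      prodL (row x) xs * pairProd row xs * (G (a x) * prodL (G ∘ a) xs)
        ≡⇒~⟨ solve 4 (λ f p g h → f :* p :* (g :* h) := f :* g :* (p :* h)) refl (prodL (row x) xs)
            (pairProd row xs) (G (a x)) (prodL (G ∘ a) xs) ⟩
      prodL (row x) xs * G (a x) * (pairProd row xs * prodL (G ∘ a) xs)
        ~⟨ ~-*ˡ (prodL (row x) xs * G (a x)) (pairs-plain xs (A ℕ.+ a x) Mxs pre) ⟩
      prodL (row x) xs * G (a x) * (H 0 xs * Suf xs)
        ≡⇒~⟨ cong (λ t → prodL (row x) xs * G (a x) * (t * Suf xs)) (trans (sym (ℚ.*-identityˡ (H 0 xs))) (sym
            (Hexc-H 0 xs))) ⟩
      prodL (row x) xs * G (a x) * (Hexc 0 xs * G (total xs) * Suf xs)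
        ≡⇒~⟨ solve 5 (λ f g h t s → f :* g :* (h :* t :* s) := f :* h :* (g :* t :* s)) refl (prodL
            (row x) xs) (G (a x)) (Hexc 0 xs) (G (total xs)) (Suf xs) ⟩
      prodL (row x) xs * Hexc 0 xs * (G (a x) * G (total xs) * Suf xs)
        ~⟨ ~-*ʳ _ (row-plain x xs A 0 Mx αx (subst (λ t → Prefix α t xs) (sym (ℕ.+-identityʳ _)) pre)) ⟩
      H (a x ℕ.+ 0) xs * (G (a x) * G (total xs) * Suf xs)
        ≡⇒~⟨ cong₂ (λ s t → H s xs * (G (a x) * G t * Suf xs)) (ℕ.+-identityʳ (a x)) (trans (sym
            (ℕ.+-identityʳ _)) (cong (λ b → total xs ℕ.+ χ b) (sym Mx))) ⟩
      H (a x) xs * (G (a x) * G (total xs ℕ.+ χ (M x)) * Suf xs)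
        ≡⇒~⟨ solve 4 (λ h g t s → h :* (g :* t :* s) := g :* h :* (t :* s)) refl (H (a x) xs) (G (a x)) (G
            (total xs ℕ.+ χ (M x))) (Suf xs) ⟩
      G (a x) * H (a x) xs * (G (total xs ℕ.+ χ (M x)) * Suf xs) ~∎

    outside-none : ∀ l → All (λ x → M x ≡ false) l → outside l ≡ total l
    outside-none [] [] = refl
    outside-none (x ∷ xs) (Mx ∷ Mxs) = cong₂ (λ b t → (if b then 0 else a x) ℕ.+ t) Mx (outside-none xs Mxs)

    pairs-star : M r ≡ false → ∀ l A → MFirst l → EndsIn l → Prefix α A l →
      pairProd row l * prodL (G ∘ a) l * (1ℚ - Q ^ suc (outside l)) ~ H 0 l * Suf l * (1ℚ - Q ^ suc (total l))
    pairs-star Mr l A (none Ms) ends pre = ~-* (pairs-plain l A Ms pre) (≡⇒~ (cong (λ t → 1ℚ - Q ^ suc t)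
        (outside-none l Ms)))
    pairs-star Mr (x ∷ []) A (Mx ∷ Ms) end pre with () ← trans (sym Mx) Mr
    pairs-star Mr (x ∷ xs) A (Mx ∷ Ms) (x≢r ∷ ends) (αx ∷ pre) =
      prodL (row x) xs * pairProd row xs * (G (a x) * prodL (G ∘ a) xs) * (1ℚ - Q ^ suc (outside (x ∷ xs)))
        ≡⇒~⟨ cong (λ b → prodL (row x) xs * pairProd row xs * (G (a x) * prodL (G ∘ a) xs) * (1ℚ - Q ^ suc
            ((if b then 0 else a x) ℕ.+ outside xs))) Mx ⟩
      prodL (row x) xs * pairProd row xs * (G (a x) * prodL (G ∘ a) xs) * (1ℚ - Q ^ suc (outside xs))
        ≡⇒~⟨ solve 5 (λ f p g h c → f :* p :* (g :* h) :* c := f :* g :* (p :* h :* c)) refl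
             (prodL (row x) xs) (pairProd row xs) (G (a x)) (prodL (G ∘ a) xs) (1ℚ - Q ^ suc (outside xs)) ⟩
      prodL (row x) xs * G (a x) * (pairProd row xs * prodL (G ∘ a) xs * (1ℚ - Q ^ suc (outside xs)))
        ~⟨ ~-*ˡ (prodL (row x) xs * G (a x)) (pairs-star Mr xs (A ℕ.+ a x) Ms ends pre) ⟩
      prodL (row x) xs * G (a x) * (H 0 xs * Suf xs * (1ℚ - Q ^ suc (total xs)))
        ≡⇒~⟨ cong (λ t → prodL (row x) xs * G (a x) * (t * Suf xs * (1ℚ - Q ^ suc (total xs)))) (trans (sym
            (ℚ.*-identityˡ (H 0 xs))) (sym (Hexc-H 0 xs))) ⟩
      prodL (row x) xs * G (a x) * (Hexc 0 xs * G (total xs) * Suf xs * (1ℚ - Q ^ suc (total xs)))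
        ≡⇒~⟨ solve 6 (λ f g h t s c → f :* g :* (h :* t :* s :* c) := f :* h :* (g :* (t :* c) :* s)) refl
             (prodL (row x) xs) (G (a x)) (Hexc 0 xs) (G (total xs)) (Suf xs) (1ℚ - Q ^ suc (total xs)) ⟩
      prodL (row x) xs * Hexc 0 xs * (G (a x) * G (suc (total xs)) * Suf xs)
        ~⟨ ~-*ʳ _ (row-star x xs A 0 Mx ends αx (subst (λ t → Prefix α t xs) (sym (ℕ.+-identityʳ _)) pre)) ⟩
      H (a x ℕ.+ 0) xs * (1ℚ - Q ^ suc (a x ℕ.+ 0 ℕ.+ total xs)) * (G (a x) * G (suc (total xs)) * Suf xs)
        ≡⇒~⟨ cong₂ (λ s t → H s xs * (1ℚ - Q ^ suc (s ℕ.+ total xs)) * (G (a x) * G t * Suf xs)) (ℕ.+-identityʳ (a x))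
             (trans (ℕ.+-comm 1 (total xs)) (cong (λ b → total xs ℕ.+ χ b) (sym Mx))) ⟩
      H (a x) xs * (1ℚ - Q ^ suc (a x ℕ.+ total xs)) * (G (a x) * G (total xs ℕ.+ χ (M x)) * Suf xs)
        ≡⇒~⟨ solve 5 (λ h c g t s → h :* c :* (g :* t :* s) := g :* h :* (t :* s) :* c) refl
             (H (a x) xs) (1ℚ - Q ^ suc (a x ℕ.+ total xs)) (G (a x)) (G (total xs ℕ.+ χ (M x))) (Suf xs) ⟩
      G (a x) * H (a x) xs * (G (total xs ℕ.+ χ (M x)) * Suf xs) * (1ℚ - Q ^ suc (a x ℕ.+ total xs)) ~∎

module SpecialisedCT {n : ℕ} (m : ℕ) (m<n : m < n) (a : Fin n → ℕ) (r : Fin n)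
  (q Q : ℚ) (qQ : q * Q ≡ 1ℚ)
  (cancel : ∀ k x y → x * (1ℚ - Q ^ suc k) ≡ y * (1ℚ - Q ^ suc k) → x ≡ y) where

  open Cyclic m m<n r
  open Prefixes a
  open Positions a p p-inj r r-top M r∉M M-initial
  open Specialised q Q qQ

  S : Fin n → Fin n → ℕ
  S = aStar m r a

  size : ℕ
  size = total (allFin n)

  d : Fin n → ℕ
  d i = (size ∸ a i) ℕ.+ χ (M i)

  a≤total : ∀ {i l} → i ∈ l → a i ≤ total l
  a≤total (here refl) = ℕ.m≤m+n _ _
  a≤total {l = x ∷ l} (there i∈) = ℕ.≤-trans (a≤total i∈) (ℕ.m≤n+m _ (a x))

  S-self : ∀ u → S u u ≡ a u
  S-self u with M u in Mu
  ... | false = ℕ.+-identityʳ _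
  ... | true = trans (cong (λ b → a u ℕ.+ χ b) (==F-≢ (M⇒≢r Mu))) (ℕ.+-identityʳ _)

  sum-χ : ∀ b l → Unique l → r ∈ l → sum (map (λ i → a i ℕ.+ χ (b ∧ (i ==F r))) l) ≡ total l ℕ.+ χ b
  sum-χ b l uniq r∈ = trans (split l) (cong (total l ℕ.+_) (count b))
    where
    split : ∀ l → sum (map (λ i → a i ℕ.+ χ (b ∧ (i ==F r))) l) ≡ total l ℕ.+ sum (map (λ i → χ (b ∧ (i ==F r))) l)
    split [] = refl
    split (x ∷ xs) = trans (cong (a x ℕ.+ χ (b ∧ (x ==F r)) ℕ.+_) (split xs)) (ℕ-interchange (a x) _ _ _)
      where
      ℕ-interchange : ∀ x y z w → x ℕ.+ y ℕ.+ (z ℕ.+ w) ≡ x ℕ.+ z ℕ.+ (y ℕ.+ w)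
      ℕ-interchange = ℕ-Solver.solve-∀
    zeros : ∀ l → sum (map (λ (i : Fin n) → 0) l) ≡ 0
    zeros [] = refl
    zeros (_ ∷ l) = zeros l
    χ-if : ∀ i → χ (i ==F r) ≡ (if r ==F i then 1 else 0)
    χ-if i with i Fin.≟ r
    ... | yes refl = sym (cong (if_then 1 else 0) (==F-refl i))
    ... | no i≢r = sym (cong (if_then 1 else 0) (==F-≢ (i≢r ∘ sym)))
    count : ∀ b → sum (map (λ i → χ (b ∧ (i ==F r))) l) ≡ χ b
    count false = zeros l
    count true = trans (Degrees.sum-cong-All S r (All.universal χ-if l)) (Degrees.δ-present S r (λ _ → 1) l uniq r∈)

  d+a : ∀ u → d u ℕ.+ a u ≡ size ℕ.+ χ (M u)
  d+a u = trans (ℕ.+-assoc (size ∸ a u) (χ (M u)) (a u)) (trans (cong (size ∸ a u ℕ.+_) (ℕ.+-comm (χ (M u)) (a u)))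
    (trans (sym (ℕ.+-assoc (size ∸ a u) (a u) (χ (M u)))) (cong (ℕ._+ χ (M u)) (ℕ.m∸n+n≡m (a≤total (∈-allFin u))))))

  degree : ∀ u → sum (map (Degrees.pairDegree S u) (pairs n)) ≤ d u
  degree u = ℕ.≤-reflexive (ℕ.+-cancelʳ-≡ (a u) _ _ (begin
    sum (map (Degrees.pairDegree S u) (pairs n)) ℕ.+ a u
      ≡⟨ cong₂ (λ l t → sum (map (Degrees.pairDegree S u) l) ℕ.+ t) (pairs≡upairs n) (sym (S-self u)) ⟩
    sum (map (Degrees.pairDegree S u) (upairs (allFin n))) ℕ.+ S u u
      ≡⟨ Degrees.pairs-present S u (allFin n) (allFin⁺ n) (∈-allFin u) ⟩
    sum (map (λ i → S i u) (allFin n))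
      ≡⟨ sum-χ (M u) (allFin n) (allFin⁺ n) (∈-allFin r) ⟩
    size ℕ.+ χ (M u)
      ≡⟨ d+a u ⟨
    d u ℕ.+ a u ∎))

  P : Poly n
  P = LHSprod n m r a

  factor : Fin n × Fin n → Poly n
  factor = pairFactor S

  P-bounded : All (Bounded d) P
  P-bounded = All.map (λ {t} → Bounded-mono degree {t})
    (Bounded-prodP (λ ij u → Degrees.pairDegree S u ij) factor
      (λ { (i , j) → All-*P (λ s t → Bounded-mul s t) (Bounded-poch 0 i j (S i j)) (Bounded-poch 1 j i (S j i)) }) (pairs n))

  phase : (Fin n → ℕ) → Fin n → Fin n → ℤ
  phase α i j = pos (χ (p j <ᵇ p i)) ℤ.+ (pos (α i) ℤ.- pos (α j))

  φ F : (Fin n → ℕ) → Fin n → Fin n → ℚ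
  φ α i j = pochℚ (pw (phase α i j)) (S i j)
  F α i j = φ α i j * φ α j i

  ev-P : ∀ α → ev (point shift d α) P ≡ pairProd (F (lookup α)) (allFin n)
  ev-P α = begin
    ev β P
      ≡⟨ Lin-prodP g char factor (pairs n) ⟩
    prodL (Lin g ∘ factor) (pairs n)
      ≡⟨ cong (prodL (Lin g ∘ factor)) (pairs≡upairs n) ⟩
    prodL (Lin g ∘ factor) (upairs (allFin n))
      ≡⟨ prodL-cong (All.map (λ { {i , j} lt → factor-value i j lt }) (upairs-All (allFin-increasing n))) ⟩
    prodL (uncurry (F (lookup α))) (upairs (allFin n))
      ≡⟨ prodL-upairs (F (lookup α)) (allFin n) ⟩
    pairProd (F (lookup α)) (allFin n) ∎
    where
    β = point shift d α
    g = λ v → pw (dot β v)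
    char = ev-char β
    regroup : ∀ s t x y → (s ℤ.+ x) ℤ.- (t ℤ.+ y) ≡ (s ℤ.- t) ℤ.+ (x ℤ.- y)
    regroup = ℤ-Solver.solve-∀
    poch-value : ∀ e i j → pos e ℤ.+ (shift i ℤ.- shift j) ≡ pos (χ (p j <ᵇ p i)) →
      Lin g (poch e (ratio i j) (S i j)) ≡ φ (lookup α) i j
    poch-value e i j eq = trans (Lin-poch g char e (ratio i j) (S i j)) (cong (λ t → pochℚ t (S i j)) (begin
      q ^ e * pw (dot β (ratio i j)) ≡⟨ pw-+ (pos e) (dot β (ratio i j)) ⟨
      pw (pos e ℤ.+ dot β (ratio i j)) ≡⟨ cong (λ t → pw (pos e ℤ.+ t)) (trans (dot-ratio β i j) (regroup
          (shift i) (shift j) _ _)) ⟩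
      pw (pos e ℤ.+ ((shift i ℤ.- shift j) ℤ.+ (pos (lookup α i) ℤ.- pos (lookup α j)))) ≡⟨ cong pw (sym
          (ℤ.+-assoc (pos e) (shift i ℤ.- shift j) (pos (lookup α i) ℤ.- pos (lookup α j)))) ⟩
      pw ((pos e ℤ.+ (shift i ℤ.- shift j)) ℤ.+ (pos (lookup α i) ℤ.- pos (lookup α j)))
        ≡⟨ cong (λ t → pw (t ℤ.+ (pos (lookup α i) ℤ.- pos (lookup α j)))) eq ⟩
      pw (phase (lookup α) i j) ∎))
    factor-value : ∀ i j → toℕ i < toℕ j → Lin g (factor (i , j)) ≡ F (lookup α) i j
    factor-value i j lt = trans (Lin-*P g char (poch 0 (ratio i j) (S i j)) (poch 1 (ratio j i) (S j i)))
      (cong₂ _*_ (poch-value 0 i j (trans (ℤ.+-identityˡ _) (proj₁ (offset lt)))) (poch-value 1 j i (proj₂ (offset lt))))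

  F-sym : ∀ α i j → F α i j ≡ F α j i
  F-sym α i j = ℚ.*-comm (φ α i j) (φ α j i)

  φ-vanish : ∀ α {i j} → Hit α i j → φ α i j ≡ 0ℚ
  φ-vanish α {i} {j} (k , k< , eq) = pochℚ-vanish (pw (phase α i j)) (S i j) k k< (begin
    q ^ k * pw (phase α i j) ≡⟨ pw-+ (pos k) (phase α i j) ⟨
    pw (pos k ℤ.+ phase α i j) ≡⟨ cong (λ t → pw (pos k ℤ.+ (pos c ℤ.+ (pos (α i) ℤ.- pos t)))) (sym eq) ⟩
    pw (pos k ℤ.+ (pos c ℤ.+ (pos (α i) ℤ.- (pos c ℤ.+ pos (α i) ℤ.+ pos k)))) ≡⟨ cong pw (cancels (pos k)
        (pos c) (pos (α i))) ⟩
    1ℚ ∎)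
    where
    c = χ (p j <ᵇ p i)
    cancels : ∀ k c x → k ℤ.+ (c ℤ.+ (x ℤ.- (c ℤ.+ x ℤ.+ k))) ≡ 0ℤ
    cancels = ℤ-Solver.solve-∀

  hit? : ∀ α i j → Dec (i ≢ j × Hit α i j)
  hit? α i j = ¬? (i Fin.≟ j) ×-dec ℕ.anyUpTo? (λ k → χ (p j <ᵇ p i) ℕ.+ α i ℕ.+ k ℕ.≟ α j) (S i j)

  order↭ : order ↭ allFin n
  order↭ = sortBy-↭ p (allFin n)

  order-unique : Unique order
  order-unique = unique-↭ (↭-sym order↭) (allFin⁺ n)

  ∈-order : ∀ i → i ∈ order
  ∈-order i = Perm.∈-resp-↭ (↭-sym order↭) (∈-allFin i)

  order-increasing : AllPairs (λ i j → p i < p j) order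
  order-increasing = Linked⇒AllPairs ℕ.<-trans
    (linked-≢ (λ le i≢j → ℕ.≤∧≢⇒< le (i≢j ∘ p-inj)) (sortBy-↗ p (allFin n)) order-unique)

  α* : Fin n → ℕ
  α* = proj₁ (prefix-sums a 0 order order-unique)

  α*-prefix : Prefix α* 0 order
  α*-prefix = proj₂ (prefix-sums a 0 order order-unique)

  open Telescope a r M α*

  ends : ∀ {l} → AllPairs (λ i j → p i < p j) l → r ∈ l → EndsIn l
  ends {_ ∷ []} (_ ∷ _) (here refl) = end
  ends {_ ∷ y ∷ _} ((lt ∷ _) ∷ _) (here refl) = contradiction lt (ℕ.≤⇒≯ (p≤pr α* y))
  ends (lts ∷ incr) (there r∈) = (λ { refl → ℕ.<-irrefl refl (All.lookup lts r∈) }) ∷ ends incr r∈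

  M-first : ∀ {l} → AllPairs (λ i j → p i < p j) l → MFirst l
  M-first [] = none []
  M-first (_∷_ {x} lts incr) with M x in Mx
  ... | true = Mx ∷ M-first incr
  ... | false = none (Mx ∷ All.map (λ {y} lt → outside-M y lt) lts)
    where
    outside-M : ∀ y → p x < p y → M y ≡ false
    outside-M y lt with M y in My
    ... | false = refl
    ... | true = contradiction lt (ℕ.<⇒≯ (M-initial My Mx))

  suffixes : ∀ A l → size ≡ A ℕ.+ total l → Prefix α* A l → Suf l ≡ prodL (λ i → G (d i ∸ α* i)) l × All (λ i → α* i ≤ d i) l
  suffixes A [] _ [] = refl , []
  suffixes A (x ∷ xs) eq (αx ∷ pre) with suffixes (A ℕ.+ a x) xs (trans eq (sym (ℕ.+-assoc A (a x) (total xs)))) pre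
  ... | eq′ , le = cong₂ (λ t s → G t * s) (sym (trans (cong₂ _∸_ dx αx) (ℕ.m+n∸m≡n A _))) eq′ ,
                   subst₂ _≤_ (sym αx) (sym dx) (ℕ.m≤m+n A _) ∷ le
    where
    dx : d x ≡ A ℕ.+ (total xs ℕ.+ χ (M x))
    dx = trans (cong (λ t → (t ∸ a x) ℕ.+ χ (M x)) (trans eq (trans (cong (A ℕ.+_) (ℕ.+-comm (a x)
        (total xs))) (sym (ℕ.+-assoc A (total xs) (a x))))))
      (trans (cong (ℕ._+ χ (M x)) (ℕ.m+n∸n≡m (A ℕ.+ total xs) (a x))) (ℕ.+-assoc A (total xs) (χ (M x))))

  order-suffixes = suffixes 0 order (sym (total-↭ order↭)) α*-prefix

  α*≤d : ∀ i → α* i ≤ d i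
  α*≤d i = All.lookup (proj₂ order-suffixes) (∈-order i)

  α₀ : Vec ℕ n
  α₀ = Vec.tabulate α*

  lookup-α₀ : ∀ i → lookup α₀ i ≡ α* i
  lookup-α₀ = lookup∘tabulate α*

  ev-vanish : ∀ α → (∀ i → lookup α i ≤ d i) → α ≢ α₀ → ev (point shift d α) P ≡ 0ℚ
  ev-vanish α α≤d α≢ with Fin.any? (λ i → Fin.any? (λ j → hit? (lookup α) i j))
  ... | yes (i , j , i≢j , hit) = trans (ev-P α) (pairProd-zero (F (lookup α)) (F-sym (lookup α))
          (trans (cong (_* φ (lookup α) j i) (φ-vanish (lookup α) hit)) (ℚ.*-zeroˡ (φ (lookup α) j i))) i≢j
              (∈-allFin i) (∈-allFin j))
  ... | no ¬hit = contradiction (trans (sym (tabulate∘lookup α)) (tabulate-cong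
      (λ i → Prefix-unique pre α*-prefix (∈-order i)))) α≢
    where
    bound : ∀ i → lookup α i ℕ.+ a i ≤ size ℕ.+ χ (M i)
    bound i = ℕ.≤-trans (ℕ.+-monoˡ-≤ (a i) (α≤d i)) (ℕ.≤-reflexive (d+a i))
    pre : Prefix (lookup α) 0 order
    pre = no-hit⇒prefix (lookup α) (λ i≢j hit → ¬hit (_ , _ , i≢j , hit)) bound

  F-row : ∀ {i j} → p i < p j → F α* i j ≡ row i j
  F-row {i} {j} lt = cong₂ _*_
    (cong₂ (λ t k → pochℚ (pw t) k) (trans (cong (λ c → pos c ℤ.+ (pos (α* i) ℤ.- pos (α* j))) (χ<-no
        (ℕ.<⇒≤ lt))) (ℤ.+-identityˡ (pos (α* i) ℤ.- pos (α* j))))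
      (trans (cong (λ b → a i ℕ.+ χ (M j ∧ b)) (==F-≢ i≢r)) (trans (cong (λ b → a i ℕ.+ χ b) (∧-zeroʳ (M j)))
          (ℕ.+-identityʳ _))))
    (cong (λ c → pochℚ (pw (pos c ℤ.+ (pos (α* j) ℤ.- pos (α* i)))) (S j i)) (χ<-yes lt))
    where
    i≢r : i ≢ r
    i≢r refl = ℕ.<⇒≱ lt (p≤pr α* j)

  ev-order : ev (point shift d α₀) P ≡ pairProd row order
  ev-order = begin
    ev (point shift d α₀) P ≡⟨ ev-P α₀ ⟩
    pairProd (F (lookup α₀)) (allFin n) ≡⟨ pairProd-↭ (F (lookup α₀)) (F-sym (lookup α₀)) (↭-sym order↭) ⟩
    pairProd (F (lookup α₀)) order ≡⟨ pairProd-cong (AllPairs.map (λ {i} {j} lt → trans (cong₂ F′ (cong₂ _,_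
        (lookup-α₀ i) (lookup-α₀ j)) refl) (F-row lt)) order-increasing) ⟩
    pairProd row order ∎
    where
    F′ : ℕ × ℕ → Fin n × Fin n → ℚ
    F′ (x , y) (i , j) = pochℚ (pw (pos (χ (p j <ᵇ p i)) ℤ.+ (pos x ℤ.- pos y))) (S i j)
      * pochℚ (pw (pos (χ (p i <ᵇ p j)) ℤ.+ (pos y ℤ.- pos x))) (S j i)

  Cancellable : ℚ → Set
  Cancellable c = ∀ x y → x * c ≡ y * c → x ≡ y

  G-cancellable : ∀ k → Cancellable (G k)
  G-cancellable zero x y eq = trans (sym (ℚ.*-identityʳ x)) (trans eq (ℚ.*-identityʳ y))
  G-cancellable (suc k) x y eq = G-cancellable k x y (cancel k _ _ (trans (ℚ.*-assoc x (G k) _) (trans eq (sym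
      (ℚ.*-assoc y (G k) _)))))

  ∏-cancellable : ∀ {k} (f : Fin k → ℚ) → (∀ i → Cancellable (f i)) → Cancellable (∏ k f)
  ∏-cancellable {zero} f c x y eq = trans (sym (ℚ.*-identityʳ x)) (trans eq (ℚ.*-identityʳ y))
  ∏-cancellable {suc k} f c x y eq = c Fin.zero x y (∏-cancellable (f ∘ Fin.suc) (c ∘ Fin.suc) _ _
    (trans (ℚ.*-assoc x (f Fin.zero) _) (trans eq (sym (ℚ.*-assoc y (f Fin.zero) _)))))

  ~-cancel : ∀ {c} → Cancellable c → ∀ {x y} → x * c ~ y * c → x ~ y
  ~-cancel {c} C {x} {y} (u , U , eq) = u , U , C x (u * y) (trans eq (sym (ℚ.*-assoc u y c)))

  ∏-order : ∀ f → ∏ n f ≡ prodL f order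
  ∏-order f = trans (sym (prodL-tabulate f n id)) (prodL-↭ f (↭-sym order↭))

  CT-value : constant (CT P) * ∏ n (λ i → G (d i)) ≡ prodL (λ i → w (d i) (α* i)) order * pairProd row order
  CT-value = begin
    constant (CT P) * ∏ n (λ i → G (d i))
      ≡⟨ interpolation shift d P P-bounded ⟩
    sumBox d (λ α → ∏ n (λ i → w (d i) (lookup α i)) * ev (point shift d α) P)
      ≡⟨ sumBox-single d (λ α → ∏ n (λ i → w (d i) (lookup α i)) * ev (point shift d α) P) α₀
           (λ i → subst (_≤ d i) (sym (lookup-α₀ i)) (α*≤d i))
           (λ α α≤ α≢ → trans (cong (∏ n (λ i → w (d i) (lookup α i)) *_) (ev-vanish α α≤ α≢)) (ℚ.*-zeroʳ (∏ n
               (λ i → w (d i) (lookup α i))))) ⟩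
    ∏ n (λ i → w (d i) (lookup α₀ i)) * ev (point shift d α₀) P
      ≡⟨ cong₂ _*_ (trans (∏-cong n (λ i → cong (w (d i)) (lookup-α₀ i))) (∏-order (λ i → w (d i) (α* i)))) ev-order ⟩
    prodL (λ i → w (d i) (α* i)) order * pairProd row order ∎

  sgn-unit : ∀ u → Unit (sgn u)
  sgn-unit zero = 0ℤ , inj₁ refl
  sgn-unit (suc u) = Unit-* (sgn-unit u) (ℤ.- pos (suc u) , inj₂ refl)

  weight : ∀ i → w (d i) (α* i) * (G (α* i) * G (d i ∸ α* i)) ~ G (d i)
  weight i = sgn (d i ∸ α* i) , sgn-unit (d i ∸ α* i) ,
    subst (λ t → w t (α* i) * (G (α* i) * G (d i ∸ α* i)) ≡ sgn (d i ∸ α* i) * G t) (ℕ.m+[n∸m]≡n (α*≤d i))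
        (w-formula (α* i) (d i ∸ α* i))

  CT~ : constant (CT P) * (prodL (G ∘ a) (allFin n) * (1ℚ - Q ^ suc (sumOutM m r a))) ~ G (absA a) * (1ℚ - Q ^ suc (absA a))
  CT~ = ~-cancel (∏-cancellable (λ i → G (d i)) (λ i → G-cancellable (d i)))
    (X * (prodL (G ∘ a) (allFin n) * (1ℚ - Q ^ suc (sumOutM m r a))) * D
      ≡⇒~⟨ cong₂ (λ s t → X * (s * (1ℚ - Q ^ suc t)) * D) (prodL-↭ (G ∘ a) (↭-sym order↭)) (sum-↭ (Perm.map⁺
          (λ v → if M v then 0 else a v) (↭-sym order↭))) ⟩
    X * (A * O) * D
      ≡⇒~⟨ solve 4 (λ x a o d → x :* (a :* o) :* d := x :* d :* (a :* o)) refl X A O D ⟩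
    X * D * (A * O)
      ≡⇒~⟨ cong (_* (A * O)) CT-value ⟩
    W * E * (A * O)
      ≡⇒~⟨ solve 4 (λ w e a o → w :* e :* (a :* o) := w :* (e :* a :* o)) refl W E A O ⟩
    W * (E * A * O)
      ~⟨ ~-*ˡ W (pairs-star r∉M order 0 (M-first order-increasing) (ends order-increasing (∈-order r)) α*-prefix) ⟩
    W * (H 0 order * Suf order * Z)
      ≡⇒~⟨ cong₂ (λ s t → W * (s * t * Z))
           (trans (sym (ℚ.*-identityˡ (H 0 order))) (trans (sym (Hexc-H 0 order)) (cong (_* G (total order))
               (Hexc-prefix α*-prefix))))
           (proj₁ order-suffixes) ⟩
    W * (B * G (total order) * C * Z)
      ≡⇒~⟨ solve 5 (λ w b g c z → w :* (b :* g :* c :* z) := w :* (b :* c) :* (g :* z)) refl W B (G (total order)) C Z ⟩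
    W * (B * C) * (G (total order) * Z)
      ~⟨ ~-*ʳ (G (total order) * Z) weights ⟩
    D * (G (total order) * Z)
      ≡⇒~⟨ trans (ℚ.*-comm D _) (cong (λ t → G t * (1ℚ - Q ^ suc t) * D) (total-↭ order↭)) ⟩
    G (absA a) * (1ℚ - Q ^ suc (absA a)) * D ~∎)
    where
    X = constant (CT P)
    D = ∏ n (λ i → G (d i))
    A = prodL (G ∘ a) order
    O = 1ℚ - Q ^ suc (outside order)
    Z = 1ℚ - Q ^ suc (total order)
    W = prodL (λ i → w (d i) (α* i)) order
    E = pairProd row order
    B = prodL (G ∘ α*) order
    C = prodL (λ i → G (d i ∸ α* i)) order
    weights : W * (B * C) ~ D
    weights = ~-trans (≡⇒~ (sym (trans (prodL-* (λ i → w (d i) (α* i)) _ order) (cong (W *_) (prodL-* (G ∘ α*) _ order)))))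
      (~-trans (~-prodL (λ i → w (d i) (α* i) * (G (α* i) * G (d i ∸ α* i))) (λ i → G (d i)) order
          (All.universal weight order))
        (≡⇒~ (sym (∏-order (λ i → G (d i))))))

-index : ∀ {n} → Fin n → ℤ
-index i = ℤ.- pos (toℕ i)

height : ∀ {n} → (Fin n → ℤ) → ℤ
height = dot -index

Small Weak : ∀ {n} → Term n → Set
Small (term _ e v) = 1 ≤ e ⊎ 0ℤ ℤ.< height v
Weak (term _ e v) = 1 ≤ e ⊎ 0ℤ ℤ.≤ height v

Small⇒Weak : ∀ {n} {t : Term n} → Small t → Weak t
Small⇒Weak (inj₁ e≥1) = inj₁ e≥1
Small⇒Weak (inj₂ h>0) = inj₂ (ℤ.<⇒≤ h>0)

Small-Weak : ∀ {n} (s t : Term n) → Small s → Weak t → Small (termMul s t)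
Small-Weak (term _ e _) (term _ f _) (inj₁ e≥1) _ = inj₁ (ℕ.≤-trans e≥1 (ℕ.m≤m+n e f))
Small-Weak (term _ e _) (term _ f _) (inj₂ _) (inj₁ f≥1) = inj₁ (ℕ.≤-trans f≥1 (ℕ.m≤n+m f e))
Small-Weak (term _ _ u) (term _ _ v) (inj₂ hu) (inj₂ hv) =
  inj₂ (subst (0ℤ ℤ.<_) (sym (dot-+ -index u v)) (ℤ.+-mono-<-≤ hu hv))

Weak-Small : ∀ {n} (s t : Term n) → Weak s → Small t → Small (termMul s t)
Weak-Small (term _ e _) (term _ f _) (inj₁ e≥1) _ = inj₁ (ℕ.≤-trans e≥1 (ℕ.m≤m+n e f))
Weak-Small (term _ e _) (term _ f _) (inj₂ _) (inj₁ f≥1) = inj₁ (ℕ.≤-trans f≥1 (ℕ.m≤n+m f e))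
Weak-Small (term _ _ u) (term _ _ v) (inj₂ hu) (inj₂ hv) =
  inj₂ (subst (0ℤ ℤ.<_) (sym (dot-+ -index u v)) (ℤ.+-mono-≤-< hu hv))

-- At q = 0 the product becomes ∏ (1 − x_i / x_j) over some pairs i < j, whose nontrivial monomials have positive height.
data Lead {n : ℕ} : Poly n → Set where
  lead : ∀ {v P} → (∀ i → v i ≡ 0ℤ) → All Small P → Lead (term 1ℤ 0 v ∷ P)

height-0 : ∀ {n} (v : Fin n → ℤ) → (∀ i → v i ≡ 0ℤ) → height v ≡ 0ℤ
height-0 {n} v v≡0 = trans (sumℤ-cong (λ i → cong ((ℤ.- pos (toℕ i)) ℤ.*_) (v≡0 i))) (dot-0 {n} -index)

Lead-*P : ∀ {n} {P P′ : Poly n} → Lead P → Lead P′ → Lead (P *P P′)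
Lead-*P (lead {v} v≡0 small) (lead {v′} v′≡0 small′) =
  lead (λ i → cong₂ ℤ._+_ (v≡0 i) (v′≡0 i)) (All.++⁺
    (All.map⁺ (All.map (λ {t} → Weak-Small (term 1ℤ 0 v) t (inj₂ (ℤ.≤-reflexive (sym (height-0 v v≡0))))) small′))
    (All-*P Small-Weak small (inj₂ (ℤ.≤-reflexive (sym (height-0 v′ v′≡0))) ∷ All.map (λ {t} → Small⇒Weak {t = t}) small′)))

Lead-prodP : ∀ {n} {A : Set} (f : A → Poly n) {l} → All (λ x → Lead (f x)) l → Lead (prodP f l)
Lead-prodP f [] = lead (λ _ → refl) []
Lead-prodP f (e ∷ es) = Lead-*P e (Lead-prodP f es)

Lead-poch : ∀ {n} e (v : Fin n → ℤ) k → 1 ≤ e ⊎ 0ℤ ℤ.< height v → Lead (poch e v k)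
Lead-poch e v k small = Lead-prodP (λ l → 1P -P mono (e ℕ.+ l) v) (All.universal (λ l → lead (λ _ → refl)
    (factor l small ∷ [])) (upTo k))
  where
  factor : ∀ l → 1 ≤ e ⊎ 0ℤ ℤ.< height v → 1 ≤ e ℕ.+ l ⊎ 0ℤ ℤ.< height v
  factor l (inj₁ e≥1) = inj₁ (ℕ.≤-trans e≥1 (ℕ.m≤m+n e l))
  factor l (inj₂ h>0) = inj₂ h>0

height-ratio : ∀ {n} {i j : Fin n} → toℕ i < toℕ j → 0ℤ ℤ.< height (ratio i j)
height-ratio {i = i} {j} i<j = subst (0ℤ ℤ.<_)
  (trans (swap-neg (pos (toℕ i)) (pos (toℕ j))) (sym (dot-ratio -index i j)))
  (subst (ℤ._< pos (toℕ j) ℤ.- pos (toℕ i)) (ℤ.+-inverseʳ (pos (toℕ i))) (ℤ.+-monoˡ-< (ℤ.- pos (toℕ i)) (ℤ.+<+ i<j)))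
  where
  swap-neg : ∀ x y → y ℤ.- x ≡ (ℤ.- x) ℤ.- (ℤ.- y)
  swap-neg = ℤ-Solver.solve-∀

Lead-LHSprod : ∀ n m r a → Lead (LHSprod n m r a)
Lead-LHSprod n m r a = Lead-prodP (pairFactor S) (subst (All (λ ij → Lead (pairFactor S ij))) (sym (pairs≡upairs n)) (All.map
  (λ { {i , j} i<j → Lead-*P (Lead-poch 0 (ratio i j) (S i j) (inj₂ (height-ratio i<j))) (Lead-poch 1
      (ratio j i) (S j i) (inj₁ ℕ.≤-refl)) })
  (upairs-All (allFin-increasing n))))
  where S = aStar m r a

CT-Small : ∀ {n} (P : Poly n) → All Small P → All Small (CT P)
CT-Small [] [] = []
CT-Small (term c e v ∷ P) (small ∷ smalls) with allZero v in eq
... | false = CT-Small P smalls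
... | true with small
...   | inj₁ e≥1 = inj₁ e≥1 ∷ CT-Small P smalls
...   | inj₂ h>0 = contradiction (subst (0ℤ ℤ.<_) (height-0 v (allZero⇒ v eq)) h>0) (ℤ.<-irrefl refl)

Lead-CT : ∀ {n} {P : Poly n} → Lead P → Lead (CT P)
Lead-CT (lead {v} {P} v≡0 smalls) rewrite allZero⇐ v v≡0 = lead (λ _ → refl) (CT-Small P smalls)

evℤ : ℤ → Poly 0 → ℤ
evℤ k [] = 0ℤ
evℤ k (term c e _ ∷ P) = c ℤ.* k ℤ.^ e ℤ.+ evℤ k P

Small-divides : ∀ k (P : Poly 0) → All Small P → ∃ λ z → evℤ k P ≡ k ℤ.* z
Small-divides k [] [] = 0ℤ , sym (ℤ.*-zeroʳ k)
Small-divides k (term c (suc e) v ∷ P) (_ ∷ smalls) with Small-divides k P smalls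
... | z , eq = c ℤ.* k ℤ.^ e ℤ.+ z , trans (cong (λ t → c ℤ.* (k ℤ.* k ℤ.^ e) ℤ.+ t) eq) (pull c k (k ℤ.^ e) z)
  where
  pull : ∀ c k x z → c ℤ.* (k ℤ.* x) ℤ.+ k ℤ.* z ≡ k ℤ.* (c ℤ.* x ℤ.+ z)
  pull = ℤ-Solver.solve-∀
Small-divides k (term c zero v ∷ P) (inj₂ (ℤ.+<+ ()) ∷ _)

Lead-evℤ : ∀ k {P : Poly 0} → Lead P → ∃ λ z → evℤ k P ≡ 1ℤ ℤ.+ k ℤ.* z
Lead-evℤ k (lead {P = P} _ smalls) with Small-divides k P smalls
... | z , eq = z , cong (λ t → 1ℤ ℤ.+ t) eq

tail : Poly 0 → Poly 0
tail [] = []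
tail (term c zero v ∷ P) = tail P
tail (term c (suc e) v ∷ P) = term c e v ∷ tail P

evℤ-tail : ∀ k P → evℤ k P ≡ qcoeff 0 P ℤ.+ k ℤ.* evℤ k (tail P)
evℤ-tail k [] = sym (trans (ℤ.+-identityˡ _) (ℤ.*-zeroʳ k))
evℤ-tail k (term c zero v ∷ P) = trans (cong (λ t → c ℤ.* 1ℤ ℤ.+ t) (evℤ-tail k P)) (regroup c (qcoeff 0 P)
    (k ℤ.* evℤ k (tail P)))
  where
  regroup : ∀ c x y → c ℤ.* 1ℤ ℤ.+ (x ℤ.+ y) ≡ c ℤ.+ x ℤ.+ y
  regroup = ℤ-Solver.solve-∀
evℤ-tail k (term c (suc e) v ∷ P) = trans (cong (λ t → c ℤ.* (k ℤ.* k ℤ.^ e) ℤ.+ t) (evℤ-tail k P))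
    (regroup c k (k ℤ.^ e) (qcoeff 0 P) (evℤ k (tail P)))
  where
  regroup : ∀ c k x y z → c ℤ.* (k ℤ.* x) ℤ.+ (y ℤ.+ k ℤ.* z) ≡ 0ℤ ℤ.+ y ℤ.+ k ℤ.* (c ℤ.* x ℤ.+ z)
  regroup = ℤ-Solver.solve-∀

qcoeff-tail : ∀ k P → qcoeff (suc k) P ≡ qcoeff k (tail P)
qcoeff-tail k [] = refl
qcoeff-tail k (term c zero v ∷ P) = trans (ℤ.+-identityˡ _) (qcoeff-tail k P)
qcoeff-tail k (term c (suc e) v ∷ P) = cong (λ t → (if does (e ℕ.≟ k) then c else 0ℤ) ℤ.+ t) (qcoeff-tail k P)

multiple-small : ∀ k (x z : ℤ) → x ≡ pos k ℤ.* z → ∣ x ∣ < k → x ≡ 0ℤ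
multiple-small k x z eq lt with ∣ x ∣ in abs
... | zero = ℤ.∣i∣≡0⇒i≡0 abs
... | suc t = contradiction (ℕ.∣⇒≤ (ℕ.divides ∣ z ∣ (trans (sym abs) (trans (cong ∣_∣ eq) (trans (ℤ.abs-*
    (pos k) z) (ℕ.*-comm k ∣ z ∣)))))) (ℕ.<⇒≱ lt)

evaluations-determine : ∀ P P′ → (∀ j → evℤ (pos (3 ℕ.+ j)) P ≡ evℤ (pos (3 ℕ.+ j)) P′) → P ≈q P′
evaluations-determine P P′ eq = coefficients
  where
  c₀ : qcoeff 0 P ≡ qcoeff 0 P′
  c₀ = ℤ.i-j≡0⇒i≡j (qcoeff 0 P) (qcoeff 0 P′) (multiple-small k _ (evℤ (pos k) (tail P′) ℤ.- evℤ (pos k) (tail P))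
    (move (qcoeff 0 P) (qcoeff 0 P′) (pos k) (evℤ (pos k) (tail P)) (evℤ (pos k) (tail P′))
      (trans (sym (evℤ-tail (pos k) P)) (trans (eq j) (evℤ-tail (pos k) P′)))) (ℕ.m≤n+m (suc j) 2))
    where
    j = ∣ qcoeff 0 P ℤ.- qcoeff 0 P′ ∣
    k = 3 ℕ.+ j
    move : ∀ x y k u v → x ℤ.+ k ℤ.* u ≡ y ℤ.+ k ℤ.* v → x ℤ.- y ≡ k ℤ.* (v ℤ.- u)
    move x y k u v e = trans (expand x y (k ℤ.* u)) (trans (cong (λ t → t ℤ.- (y ℤ.+ k ℤ.* u)) e) (collect y k u v))
      where
      expand : ∀ x y t → x ℤ.- y ≡ (x ℤ.+ t) ℤ.- (y ℤ.+ t)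
      expand = ℤ-Solver.solve-∀
      collect : ∀ y k u v → (y ℤ.+ k ℤ.* v) ℤ.- (y ℤ.+ k ℤ.* u) ≡ k ℤ.* (v ℤ.- u)
      collect = ℤ-Solver.solve-∀
  tails : ∀ j → evℤ (pos (3 ℕ.+ j)) (tail P) ≡ evℤ (pos (3 ℕ.+ j)) (tail P′)
  tails j = ℤ.*-cancelˡ-≡ k _ _ (+-cancelˡ (qcoeff 0 P) _ _ (trans (sym (evℤ-tail k P)) (trans (eq j)
    (trans (evℤ-tail k P′) (cong (ℤ._+ k ℤ.* evℤ k (tail P′)) (sym c₀))))))
    where k = pos (3 ℕ.+ j)
  coefficients : P ≈q P′
  coefficients zero = c₀
  coefficients (suc k) = trans (qcoeff-tail k P) (trans (evaluations-determine (tail P) (tail P′) tails k)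
      (sym (qcoeff-tail k P′)))

ι-inverse : ∀ j → ι (pos (suc j)) * (1ℤ ℚ./ suc j) ≡ 1ℚ
ι-inverse j = ℚ.toℚᵘ-injective (ℚᵘ.≃-trans (ℚ.toℚᵘ-homo-* (ι (pos (suc j))) (1ℤ ℚ./ suc j))
  (ℚᵘ.≃-trans (ℚᵘ.*-cong (ℚ.toℚᵘ-fromℚᵘ (ℚᵘ.mkℚᵘ (pos (suc j)) 0)) (ℚ.toℚᵘ-fromℚᵘ (ℚᵘ.mkℚᵘ 1ℤ j)))
    (ℚᵘ.*≡* (swap1 (pos (suc j))))))
  where
  swap1 : ∀ x → x ℤ.* 1ℤ ℤ.* 1ℤ ≡ 1ℤ ℤ.* (1ℤ ℤ.* x)
  swap1 = ℤ-Solver.solve-∀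

ι-^ : ∀ x k → ι (x ℤ.^ k) ≡ ι x ^ k
ι-^ x zero = refl
ι-^ x (suc k) = trans (ι-* x (x ℤ.^ k)) (cong (ι x *_) (ι-^ x k))

pos-^ : ∀ x k → pos (x ℕ.^ k) ≡ pos x ℤ.^ k
pos-^ x zero = refl
pos-^ x (suc k) = trans (ℤ.pos-* x (x ℕ.^ k)) (cong (pos x ℤ.*_) (pos-^ x k))

module _ (j : ℕ) where
  private
    k = 3 ℕ.+ j
    q Q : ℚ
    q = ι (pos k)
    Q = 1ℤ ℚ./ k
    qQ : q * Q ≡ 1ℚ
    qQ = ι-inverse (2 ℕ.+ j)

  open Specialised q Q qQ

  cancel : ∀ e x y → x * (1ℚ - Q ^ suc e) ≡ y * (1ℚ - Q ^ suc e) → x ≡ y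
  cancel e x y eq = begin
    x ≡⟨ undo x ⟨
    x * c * (q ^ suc e * I) ≡⟨ cong (_* (q ^ suc e * I)) eq ⟩
    y * c * (q ^ suc e * I) ≡⟨ undo y ⟩
    y ∎
    where
    c = 1ℚ - Q ^ suc e
    1<power : 1 < k ℕ.^ suc e
    1<power = ℕ.≤-trans (s≤s (s≤s z≤n)) (ℕ.≤-trans (ℕ.≤-reflexive (sym (ℕ.*-identityʳ k))) (ℕ.*-monoʳ-≤ k (ℕ.m^n>0 k e)))
    t = k ℕ.^ suc e ℕ.∸ 2
    I = 1ℤ ℚ./ suc t
    power : q ^ suc e ≡ 1ℚ + ι (pos (suc t))
    power = begin
      q ^ suc e ≡⟨ ι-^ (pos k) (suc e) ⟨
      ι (pos k ℤ.^ suc e) ≡⟨ cong ι (pos-^ k (suc e)) ⟨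
      ι (pos (k ℕ.^ suc e)) ≡⟨ cong (ι ∘ pos) (ℕ.m+[n∸m]≡n 1<power) ⟨
      ι (pos (suc (suc t))) ≡⟨ ι-+ 1ℤ (pos (suc t)) ⟩
      1ℚ + ι (pos (suc t)) ∎
    undo : ∀ x → x * c * (q ^ suc e * I) ≡ x
    undo x = begin
      x * (1ℚ - Q ^ suc e) * (q ^ suc e * I)
        ≡⟨ solve 4 (λ x y z i → x :* (con 1ℚ :- y) :* (z :* i) := x :* ((z :- z :* y) :* i)) refl x
            (Q ^ suc e) (q ^ suc e) I ⟩
      x * ((q ^ suc e - q ^ suc e * Q ^ suc e) * I)
        ≡⟨ cong₂ (λ u v → x * ((u - v) * I)) power (q^Q^ (suc e)) ⟩
      x * ((1ℚ + ι (pos (suc t)) - 1ℚ) * I)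
        ≡⟨ cong (λ u → x * (u * I)) (solve 1 (λ y → con 1ℚ :+ y :- con 1ℚ := y) refl (ι (pos (suc t)))) ⟩
      x * (ι (pos (suc t)) * I)
        ≡⟨ cong (x *_) (ι-inverse t) ⟩
      x * 1ℚ
        ≡⟨ ℚ.*-identityʳ x ⟩
      x ∎

  constant-evℤ : ∀ P → constant P ≡ ι (evℤ (pos k) P)
  constant-evℤ [] = refl
  constant-evℤ (term c e v ∷ P) = sym (trans (ι-+ (c ℤ.* pos k ℤ.^ e) (evℤ (pos k) P)) (cong₂ _+_
    (trans (ι-* c (pos k ℤ.^ e)) (trans (cong (ι c *_) (ι-^ (pos k) e)) (sym (ℚ.*-identityʳ _)))) (sym (constant-evℤ P))))

  not-multiple : ∀ c z y → 0 < c → c < k → pos c ℤ.+ pos k ℤ.* z ≢ pos k ℤ.* y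
  not-multiple c z y 0<c c<k eq = ℕ.<⇒≢ 0<c (sym (ℤ.+-injective (multiple-small k (pos c) (y ℤ.- z) (trans
      (move (pos c) (pos k ℤ.* z))
    (trans (cong (ℤ._- pos k ℤ.* z) eq) (collect (pos k) y z))) c<k)))
    where
    move : ∀ c t → c ≡ (c ℤ.+ t) ℤ.- t
    move = ℤ-Solver.solve-∀
    collect : ∀ k y z → k ℤ.* y ℤ.- k ℤ.* z ≡ k ℤ.* (y ℤ.- z)
    collect = ℤ-Solver.solve-∀

  not-power : ∀ x y z t → x ≡ 1ℤ ℤ.+ pos k ℤ.* z → x ≢ pos k ℤ.^ suc t ℤ.* y
  not-power x y z t x≡ eq = not-multiple 1 z (pos k ℤ.^ t ℤ.* y) (s≤s z≤n) (s≤s (s≤s z≤n))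
    (trans (sym x≡) (trans eq (ℤ.*-assoc (pos k) (pos k ℤ.^ t) y)))

  ι-power : ∀ t y → ι (pos k ℤ.^ t ℤ.* y) ≡ q ^ t * ι y
  ι-power t y = trans (ι-* (pos k ℤ.^ t) y) (cong (_* ι y) (ι-^ (pos k) t))

  Q-to-q : ∀ t x y → x ≡ Q ^ t * y → y ≡ q ^ t * x
  Q-to-q t x y eq = begin
    y ≡⟨ ℚ.*-identityˡ y ⟨
    1ℚ * y ≡⟨ cong (_* y) (q^Q^ t) ⟨
    q ^ t * Q ^ t * y ≡⟨ ℚ.*-assoc (q ^ t) (Q ^ t) y ⟩
    q ^ t * (Q ^ t * y) ≡⟨ cong (q ^ t *_) eq ⟨
    q ^ t * x ∎

  neg-out : ∀ u y → - u * ι y ≡ u * ι (ℤ.- y)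
  neg-out u y = trans (solve 2 (λ u y → :- u :* y := u :* :- y) refl u (ι y)) (cong (u *_) (sym (ι-neg y)))

  unit-trivial : ∀ x y z z′ → x ≡ 1ℤ ℤ.+ pos k ℤ.* z → y ≡ 1ℤ ℤ.+ pos k ℤ.* z′ → ι x ~ ι y → x ≡ y
  unit-trivial x y z z′ x≡ y≡ (_ , (pos zero , inj₁ refl) , eq) = ι-injective (trans eq (ℚ.*-identityˡ (ι y)))
  unit-trivial x y z z′ x≡ y≡ (_ , (pos (suc t) , inj₁ refl) , eq) =
    contradiction (ι-injective (trans eq (sym (ι-power (suc t) y)))) (not-power x y z t x≡)
  unit-trivial x y z z′ x≡ y≡ (_ , (-[1+ t ] , inj₁ refl) , eq) =
    contradiction (ι-injective (trans (Q-to-q (suc t) (ι x) (ι y) eq) (sym (ι-power (suc t) x)))) (not-power y x z′ t y≡)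
  unit-trivial x y z z′ x≡ y≡ (_ , (pos zero , inj₂ refl) , eq) =
    contradiction (begin
      pos 2 ℤ.+ pos k ℤ.* (z ℤ.+ z′) ≡⟨ regroup (pos k) z z′ ⟩
      (1ℤ ℤ.+ pos k ℤ.* z) ℤ.+ (1ℤ ℤ.+ pos k ℤ.* z′) ≡⟨ cong₂ ℤ._+_ (trans (sym x≡) x≡-y) (sym y≡) ⟩
      (ℤ.- y) ℤ.+ y ≡⟨ ℤ.+-inverseˡ y ⟩
      0ℤ ≡⟨ ℤ.*-zeroʳ (pos k) ⟨
      pos k ℤ.* 0ℤ ∎) (not-multiple 2 (z ℤ.+ z′) 0ℤ (s≤s z≤n) (s≤s (s≤s (s≤s z≤n))))
    where
    x≡-y : x ≡ ℤ.- y
    x≡-y = ι-injective (trans eq (trans (neg-out 1ℚ y) (ℚ.*-identityˡ (ι (ℤ.- y)))))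
    regroup : ∀ k z z′ → pos 2 ℤ.+ k ℤ.* (z ℤ.+ z′) ≡ (1ℤ ℤ.+ k ℤ.* z) ℤ.+ (1ℤ ℤ.+ k ℤ.* z′)
    regroup = ℤ-Solver.solve-∀
  unit-trivial x y z z′ x≡ y≡ (_ , (pos (suc t) , inj₂ refl) , eq) =
    contradiction (ι-injective (trans eq (trans (neg-out (q ^ suc t) y) (sym (ι-power (suc t) (ℤ.- y))))))
        (not-power x (ℤ.- y) z t x≡)
  unit-trivial x y z z′ x≡ y≡ (_ , (-[1+ t ] , inj₂ refl) , eq) =
    contradiction (trans (sym (ℤ.neg-involutive y)) (trans (cong ℤ.-_ (ι-injective
      (trans (Q-to-q (suc t) (ι x) (ι (ℤ.- y)) (trans eq (neg-out (Q ^ suc t) y))) (sym (ι-power (suc t) x)))))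
      (ℤ.neg-distribʳ-* (pos k ℤ.^ suc t) x))) (not-power y (ℤ.- x) z′ t y≡)

  constant-1-qpow : ∀ e → constant (1P -P qpow e) ~ 1ℚ - Q ^ e
  constant-1-qpow e = ~-trans (≡⇒~ (trans (Lin-1-mono _ constant-char e zeroVec) (cong (λ t → 1ℚ - t)
      (ℚ.*-identityʳ (q ^ e))))) (1-q~1-Q e)

  constant-qfac : ∀ e → constant (qfac e) ~ G e
  constant-qfac e = ~-trans (≡⇒~ (trans (Lin-poch _ constant-char 1 zeroVec e)
    (trans (cong (λ t → pochℚ t e) (ℚ.*-identityʳ (q ^ 1))) (sym (ℚ.*-identityʳ _))))) (poch-up 0 e)

  identity-at : ∀ n m → m < n → (a : Fin n → ℕ) (r : Fin n) →
    evℤ (pos k) (CT (LHSprod n m r a) *P ((1P -P qpow (suc (sumOutM m r a))) *P prodP (λ i → qfac (a i)) (allFin n)))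
      ≡ evℤ (pos k) ((1P -P qpow (suc (absA a))) *P qfac (absA a))
  identity-at n m m<n a r = unit-trivial (evℤ (pos k) lhs) (evℤ (pos k) rhs)
    (proj₁ (Lead-evℤ (pos k) lhs-lead)) (proj₁ (Lead-evℤ (pos k) rhs-lead)) (proj₂ (Lead-evℤ
        (pos k) lhs-lead)) (proj₂ (Lead-evℤ (pos k) rhs-lead))
    (ι (evℤ (pos k) lhs)
      ≡⇒~⟨ trans (sym (constant-evℤ lhs)) (trans (Lin-*P _ constant-char (CT (LHSprod n m r a)) (A *P B))
          (cong (X *_) (Lin-*P _ constant-char A B))) ⟩
    X * (constant A * constant B)
      ~⟨ ~-*ˡ X (~-* (constant-1-qpow (suc (sumOutM m r a))) B~) ⟩
    X * ((1ℚ - Q ^ suc (sumOutM m r a)) * prodL (G ∘ a) (allFin n))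
      ≡⇒~⟨ cong (X *_) (ℚ.*-comm (1ℚ - Q ^ suc (sumOutM m r a)) (prodL (G ∘ a) (allFin n))) ⟩
    X * (prodL (G ∘ a) (allFin n) * (1ℚ - Q ^ suc (sumOutM m r a)))
      ~⟨ SpecialisedCT.CT~ m m<n a r q Q qQ cancel ⟩
    G (absA a) * (1ℚ - Q ^ suc (absA a))
      ≡⇒~⟨ ℚ.*-comm (G (absA a)) (1ℚ - Q ^ suc (absA a)) ⟩
    (1ℚ - Q ^ suc (absA a)) * G (absA a)
      ~⟨ ~-* (~-sym (constant-1-qpow (suc (absA a)))) (~-sym (constant-qfac (absA a))) ⟩
    constant C * constant (qfac (absA a))
      ≡⇒~⟨ trans (sym (Lin-*P _ constant-char C (qfac (absA a)))) (constant-evℤ rhs) ⟩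
    ι (evℤ (pos k) rhs) ~∎)
    where
    X = constant (CT (LHSprod n m r a))
    A B C lhs rhs : Poly 0
    A = 1P -P qpow (suc (sumOutM m r a))
    B = prodP (λ i → qfac (a i)) (allFin n)
    C = 1P -P qpow (suc (absA a))
    lhs = CT (LHSprod n m r a) *P (A *P B)
    rhs = C *P qfac (absA a)
    B~ : constant B ~ prodL (G ∘ a) (allFin n)
    B~ = ~-trans (≡⇒~ (Lin-prodP _ constant-char (λ i → qfac (a i)) (allFin n)))
      (~-prodL (λ i → constant (qfac (a i))) (G ∘ a) (allFin n) (All.universal (λ i → constant-qfac (a i)) (allFin n)))
    lead-1-qpow : ∀ e → Lead {0} (1P -P qpow (suc e))
    lead-1-qpow e = lead (λ _ → refl) (inj₁ (s≤s z≤n) ∷ [])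
    lead-qfac : ∀ e → Lead {0} (qfac e)
    lead-qfac e = Lead-poch 1 zeroVec e (inj₁ ℕ.≤-refl)
    lhs-lead : Lead lhs
    lhs-lead = Lead-*P (Lead-CT (Lead-LHSprod n m r a)) (Lead-*P (lead-1-qpow (sumOutM m r a)) (Lead-prodP
        (λ i → qfac (a i)) (All.universal (λ i → lead-qfac (a i)) (allFin n))))
    rhs-lead : Lead rhs
    rhs-lead = Lead-*P (lead-1-qpow (absA a)) (lead-qfac (absA a))

theorem6 : (n m : ℕ) → 1 ≤ n → m < n → (a : Fin n → ℕ) → (r : Fin n) →
    (CT (LHSprod n m r a) *P ((1P -P qpow (suc (sumOutM m r a))) *P prodP (λ i → qfac (a i)) (allFin n)))
    ≈q ((1P -P qpow (suc (absA a))) *P qfac (absA a))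
theorem6 n m _ m<n a r = evaluations-determine
  (CT (LHSprod n m r a) *P ((1P -P qpow (suc (sumOutM m r a))) *P prodP (λ i → qfac (a i)) (allFin n)))
  ((1P -P qpow (suc (absA a))) *P qfac (absA a)) (λ j → identity-at j n m m<n a r)
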